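{- Let $\mathbf{D}$ be a finite set of constraints and $\beta$ a constraint of the concrete domain $\mathcal{D}_{\mathbb{Q},\mathit{diff}}$. On input $\bigwedge\mathbf{D}\to\beta$, Algorithm 2 (given in the context) terminates in time polynomial in the size of $\bigwedge\mathbf{D}\to\beta$, and it returns $\mathsf{true}$ if and only if $\mathcal{D}_{\mathbb{Q},\mathit{diff}}\models\bigwedge\mathbf{D}\to\beta$.
   Context: **The concrete domain $\mathcal{D}_{\mathbb{Q},\mathit{diff}}$** has domain $\mathbb{Q}$. Its constraints, over a set of variables, are $\top(x)$ (always true), $\bot$ (always false), $x=q$, $x>q$ and $x+q=y$ for variables $x,y$ and constants $q\in\mathbb{Q}$, with their natural semantics. The constraint $\top(x)$ is represented by the equivalent constraint $x+0=x$. The implication $\bigwedge\mathbf{D}\to\beta$ is valid, written $\mathcal{D}_{\mathbb{Q},\mathit{diff}}\models\bigwedge\mathbf{D}\to\beta$, if every assignment of rational numbers to the variables that satisfies all constraints in $\mathbf{D}$ also satisfies $\beta$. **Saturation.** $\mathsf{saturate}(\mathbf{D})$ is the set obtained from $\mathbf{D}$ by exhaustively applying the following rules (variables range over those occurring in the input): - $\mathsf{R}_{\neq}$: from $x=q$ and $x=p$ with $q\neq p$ derive $\bot$. - $\mathsf{R}_{\neq}^{+}$: from $x+q=y$ and $x+p=y$ with $q\neq p$ derive $\bot$. - $\mathsf{R}_{<}$: from $x=q$ and $x>p$ with $q<p$ derive $\bot$. - $\mathsf{R}_{ - }$: from $x=q$ and $y=p$ derive $x+(p-q)=y$. - $\mathsf{R}_{\leftrightarrow}$: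 from $x+q=y$ derive $y+(-q)=x$. - $\mathsf{R}_{0}$: derive $x+0=x$ (no premises). - $\mathsf{R}_{+}$: from $x+q=y$ and $y+p=z$ derive $x+(q+p)=z$. - $\mathsf{R}_{=}$: from $x=q$ and $x+p=y$ derive $y=q+p$. - $\mathsf{R}_{>}$: from $x>q$ and $x+p=y$ derive $y>q+p$. The three rules deriving $\bot$ are applied eagerly, and saturation stops as soon as $\bot$ is derived; the other rules are prioritized in the order $\mathsf{R}_-,\mathsf{R}_\leftrightarrow,\mathsf{R}_0,\mathsf{R}_+,\mathsf{R}_=,\mathsf{R}_>$. **Algorithm 2.** Input: an implication $\bigwedge\mathbf{D}\to\beta$. 1. $\mathbf{D}':=\mathsf{saturate}(\mathbf{D})$. 2. If $\bot\in\mathbf{D}'$ or $\beta\in\mathbf{D}'$, return $\mathsf{true}$. 3. If $\beta$ is of the form $x>q$: if $\mathbf{D}'$ contains $x=p$ for some $p>q$, return $\mathsf{true}$; if $\mathbf{D}'$ contains $x>p$ for some $p\ge q$, return $\mathsf{true}$. 4. Return $\mathsf{false}$.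
   Formalization: Rule R_< is applied with side condition q ≤ p instead of q < p: as stated, for D = {x=0, x>0} and β = ⊥ the implication is valid but ⊥ is never derived, so Algorithm 2 would wrongly return false. -}

module Defs where

open import Data.Bool using (Bool; true; false; if_then_else_; not; _∧_; _∨_)
open import Data.Integer using (∣_∣)
open import Data.List using (List; []; _∷_; [_]; _++_; length; map; concatMap)
open import Data.List.Membership.Propositional using (_∈_)
open import Data.List.Relation.Unary.All using (All)
open import Data.Nat using (ℕ; suc; _≤_)
import Data.Nat as ℕ
open import Data.Nat.ListAction using (sum)
open import Data.Nat.Logarithm using (⌊log₂_⌋)
open import Data.Product using (∃; ∃₂)
open import Data.Rational using (ℚ; 0ℚ; _+_; _-_; -_; _>_; ↥_; ↧ₙ_)
import Data.Rational.Properties as ℚ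
open import Data.Sum using (_⊎_)
open import Data.Unit using () renaming (⊤ to True)
open import Data.Empty using () renaming (⊥ to False)
open import Function.Bundles using (_⇔_)
open import Induction.WellFounded using (Acc)
open import Relation.Binary.Definitions using (DecidableEquality)
open import Relation.Binary.PropositionalEquality using (_≡_; refl)
open import Relation.Nullary using (yes; no; does)

Var : Set
Var = ℕ

infix 5 _≐_ _≻_ _⊕_≐_

data Constraint : Set where
  ⊤ᶜ    : Var → Constraint
  ⊥ᶜ    : Constraint
  _≐_   : Var → ℚ → Constraint
  _≻_   : Var → ℚ → Constraint
  _⊕_≐_ : Var → ℚ → Var → Constraint

Assignment : Set
Assignment = Var → ℚ

_satisfies_ : Assignment → Constraint → Set
v satisfies ⊤ᶜ x        = True
v satisfies ⊥ᶜ          = False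
v satisfies (x ≐ q)     = v x ≡ q
v satisfies (x ≻ q)     = v x > q
v satisfies (x ⊕ q ≐ y) = v x + q ≡ v y

infix 4 _⊨_

_⊨_ : List Constraint → Constraint → Set
D ⊨ β = ∀ v → All (v satisfies_) D → v satisfies β

infix 4 _≟_

_≟_ : DecidableEquality Constraint
⊤ᶜ x ≟ ⊤ᶜ y with x ℕ.≟ y
... | yes refl = yes refl
... | no x≢y = no λ { refl → x≢y refl }
⊥ᶜ ≟ ⊥ᶜ = yes refl
x ≐ q ≟ y ≐ p with x ℕ.≟ y | q ℚ.≟ p
... | yes refl | yes refl = yes refl
... | no x≢y | _ = no λ { refl → x≢y refl }
... | _ | no q≢p = no λ { refl → q≢p refl }
x ≻ q ≟ y ≻ p with x ℕ.≟ y | q ℚ.≟ p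
... | yes refl | yes refl = yes refl
... | no x≢y | _ = no λ { refl → x≢y refl }
... | _ | no q≢p = no λ { refl → q≢p refl }
x ⊕ q ≐ y ≟ x′ ⊕ p ≐ y′ with x ℕ.≟ x′ | q ℚ.≟ p | y ℕ.≟ y′
... | yes refl | yes refl | yes refl = yes refl
... | no x≢x′ | _ | _ = no λ { refl → x≢x′ refl }
... | _ | no q≢p | _ = no λ { refl → q≢p refl }
... | _ | _ | no y≢y′ = no λ { refl → y≢y′ refl }
⊤ᶜ _ ≟ ⊥ᶜ = no λ ()
⊤ᶜ _ ≟ _ ≐ _ = no λ ()
⊤ᶜ _ ≟ _ ≻ _ = no λ ()
⊤ᶜ _ ≟ _ ⊕ _ ≐ _ = no λ ()
⊥ᶜ ≟ ⊤ᶜ _ = no λ ()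
⊥ᶜ ≟ _ ≐ _ = no λ ()
⊥ᶜ ≟ _ ≻ _ = no λ ()
⊥ᶜ ≟ _ ⊕ _ ≐ _ = no λ ()
_ ≐ _ ≟ ⊤ᶜ _ = no λ ()
_ ≐ _ ≟ ⊥ᶜ = no λ ()
_ ≐ _ ≟ _ ≻ _ = no λ ()
_ ≐ _ ≟ _ ⊕ _ ≐ _ = no λ ()
_ ≻ _ ≟ ⊤ᶜ _ = no λ ()
_ ≻ _ ≟ ⊥ᶜ = no λ ()
_ ≻ _ ≟ _ ≐ _ = no λ ()
_ ≻ _ ≟ _ ⊕ _ ≐ _ = no λ ()
_ ⊕ _ ≐ _ ≟ ⊤ᶜ _ = no λ ()
_ ⊕ _ ≐ _ ≟ ⊥ᶜ = no λ ()
_ ⊕ _ ≐ _ ≟ _ ≐ _ = no λ ()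
_ ⊕ _ ≐ _ ≟ _ ≻ _ = no λ ()

represent : Constraint → Constraint
represent (⊤ᶜ x) = x ⊕ 0ℚ ≐ x
represent c      = c

vars : Constraint → List Var
vars (⊤ᶜ x)      = [ x ]
vars ⊥ᶜ          = []
vars (x ≐ _)     = [ x ]
vars (x ≻ _)     = [ x ]
vars (x ⊕ _ ≐ y) = x ∷ y ∷ []

bits : ℕ → ℕ
bits n = suc ⌊log₂ n ⌋

-- One further bit for the sign.
bitsℚ : ℚ → ℕ
bitsℚ q = suc (bits ∣ ↥ q ∣ ℕ.+ bits (↧ₙ q))

sizeᶜ : Constraint → ℕ
sizeᶜ (⊤ᶜ x)      = suc (bits x)
sizeᶜ ⊥ᶜ          = 1
sizeᶜ (x ≐ q)     = suc (bits x ℕ.+ bitsℚ q)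
sizeᶜ (x ≻ q)     = suc (bits x ℕ.+ bitsℚ q)
sizeᶜ (x ⊕ q ≐ y) = suc (bits x ℕ.+ bitsℚ q ℕ.+ bits y)

size : List Constraint → Constraint → ℕ
size D β = sum (map sizeᶜ (β ∷ D))

PolynomiallyBounded : (ℕ → ℕ) → Set
PolynomiallyBounded f = ∃₂ λ c k → ∀ n → f n ≤ c ℕ.* n ℕ.^ k ℕ.+ c

record Timed (A : Set) : Set where
  constructor _after_
  field
    value : A
    time  : ℕ

open Timed public

infixl 1 _>>=_

_>>=_ : {A B : Set} → Timed A → (A → Timed B) → Timed B
m >>= f = value (f (value m)) after (time m ℕ.+ time (f (value m)))

return : {A : Set} → A → Timed A
return a = a after 0

tick : {A : Set} → Timed A → Timed A
tick m = value m after suc (time m)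

-- Appending takes time linear in the length of the left list.
append : {A : Set} → List A → List A → Timed (List A)
append xs ys = (xs ++ ys) after suc (length xs)

forEach : {A B : Set} → List A → (A → Timed (List B)) → Timed (List B)
forEach []       f = tick (return [])
forEach (a ∷ as) f = do
  xs ← f a
  ys ← forEach as f
  append xs ys

exists : {A : Set} → List A → (A → Timed Bool) → Timed Bool
exists []       f = tick (return false)
exists (a ∷ as) f = do
  b ← tick (f a)
  if b then return true else exists as f

-- An elementary operation (a comparison of variables,
-- rationals or constraints, or an addition, subtraction or negation of
-- rationals) on operands of n bits in total takes time suc (κ n).

module Algorithm (κ : ℕ → ℕ) where

  elementary : {A : Set} → ℕ → A → Timed A
  elementary n a = a after suc (κ n)

  infix 4 _==ᵛ_ _==ᵠ_ _<ᵠ_ _≤ᵠ_ _==ᶜ_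
  infixl 6 _+ᵠ_ _-ᵠ_

  _==ᵛ_ : Var → Var → Timed Bool
  x ==ᵛ y = elementary (bits x ℕ.+ bits y) (does (x ℕ.≟ y))

  _==ᵠ_ _<ᵠ_ _≤ᵠ_ : ℚ → ℚ → Timed Bool
  q ==ᵠ p = elementary (bitsℚ q ℕ.+ bitsℚ p) (does (q ℚ.≟ p))
  q <ᵠ p  = elementary (bitsℚ q ℕ.+ bitsℚ p) (does (q ℚ.<? p))
  q ≤ᵠ p  = elementary (bitsℚ q ℕ.+ bitsℚ p) (does (q ℚ.≤? p))

  _+ᵠ_ _-ᵠ_ : ℚ → ℚ → Timed ℚ
  q +ᵠ p = elementary (bitsℚ q ℕ.+ bitsℚ p) (q + p)
  q -ᵠ p = elementary (bitsℚ q ℕ.+ bitsℚ p) (q - p)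

  negᵠ : ℚ → Timed ℚ
  negᵠ q = elementary (bitsℚ q) (- q)

  _==ᶜ_ : Constraint → Constraint → Timed Bool
  c ==ᶜ d = elementary (sizeᶜ c ℕ.+ sizeᶜ d) (does (c ≟ d))

  _∈?_ : Constraint → List Constraint → Timed Bool
  c ∈? D = exists D (c ==ᶜ_)

  -- The conclusions, at most one, of a rule for the given premises.

  R≠ R≠⁺ R< R- R+ R= R> : Constraint → Constraint → Timed (List Constraint)

  R≠ (x ≐ q) (x′ ≐ p) = do
    same  ← x ==ᵛ x′
    equal ← q ==ᵠ p
    return (if same ∧ not equal then [ ⊥ᶜ ] else [])
  R≠ _ _ = return []

  R≠⁺ (x ⊕ q ≐ y) (x′ ⊕ p ≐ y′) = do
    sameˡ ← x ==ᵛ x′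
    sameʳ ← y ==ᵛ y′
    equal ← q ==ᵠ p
    return (if sameˡ ∧ sameʳ ∧ not equal then [ ⊥ᶜ ] else [])
  R≠⁺ _ _ = return []

  -- The side condition is q ≤ p rather than q < p: the set {x = q, x > q} is
  -- unsatisfiable, but no other rule derives ⊥ from it.
  R< (x ≐ q) (x′ ≻ p) = do
    same  ← x ==ᵛ x′
    below ← q ≤ᵠ p
    return (if same ∧ below then [ ⊥ᶜ ] else [])
  R< _ _ = return []

  R- (x ≐ q) (y ≐ p) = do
    r ← p -ᵠ q
    return [ x ⊕ r ≐ y ]
  R- _ _ = return []

  R+ (x ⊕ q ≐ y) (y′ ⊕ p ≐ z) = do
    same ← y ==ᵛ y′
    r    ← q +ᵠ p
    return (if same then [ x ⊕ r ≐ z ] else [])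
  R+ _ _ = return []

  R= (x ≐ q) (x′ ⊕ p ≐ y) = do
    same ← x ==ᵛ x′
    r    ← q +ᵠ p
    return (if same then [ y ≐ r ] else [])
  R= _ _ = return []

  R> (x ≻ q) (x′ ⊕ p ≐ y) = do
    same ← x ==ᵛ x′
    r    ← q +ᵠ p
    return (if same then [ y ≻ r ] else [])
  R> _ _ = return []

  R↔ : Constraint → Timed (List Constraint)
  R↔ (x ⊕ q ≐ y) = do
    r ← negᵠ q
    return [ y ⊕ r ≐ x ]
  R↔ _ = return []

  R₀ : Var → Timed (List Constraint)
  R₀ x = return [ x ⊕ 0ℚ ≐ x ]

  pairs : (Constraint → Constraint → Timed (List Constraint)) →
          List Constraint → Timed (List Constraint)
  pairs R D = forEach D λ c → forEach D λ d → R c d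

  -- The rules for the variables xs, by decreasing priority.
  rules : List Var → List (List Constraint → Timed (List Constraint))
  rules xs =
    pairs R≠ ∷ pairs R≠⁺ ∷ pairs R< ∷
    pairs R- ∷ (λ D → forEach D R↔) ∷ (λ D → forEach xs R₀) ∷
    pairs R+ ∷ pairs R= ∷ pairs R> ∷ []

  notIn : List Constraint → List Constraint → Timed (List Constraint)
  notIn D cs = forEach cs λ c → do
    b ← c ∈? D
    return (if b then [] else [ c ])

  -- The new conclusions of the first rule that has any.
  firstNew : List (List Constraint → Timed (List Constraint)) →
             List Constraint → Timed (List Constraint)
  firstNew []       D = tick (return [])
  firstNew (R ∷ Rs) D = do
    cs ← R D
    new ← notIn D cs
    orElse new
    where
    orElse : List Constraint → Timed (List Constraint)
    orElse []       = firstNew Rs D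
    orElse (c ∷ cs) = return (c ∷ cs)

  -- Saturation stops when there are no candidates left, and so once ⊥ is
  -- present.
  candidates : List Var → List Constraint → Timed (List Constraint)
  candidates xs D = do
    stop ← ⊥ᶜ ∈? D
    if stop then return [] else firstNew (rules xs) D

  equalityAbove lowerBoundAbove : Var → ℚ → Constraint → Timed Bool

  equalityAbove x q (x′ ≐ p) = do
    same  ← x ==ᵛ x′
    above ← q <ᵠ p
    return (same ∧ above)
  equalityAbove x q _ = return false

  lowerBoundAbove x q (x′ ≻ p) = do
    same  ← x ==ᵛ x′
    above ← q ≤ᵠ p
    return (same ∧ above)
  lowerBoundAbove x q _ = return false

  bounded : List Constraint → Constraint → Timed Bool
  bounded D′ (x ≻ q) = do
    e ← exists D′ (equalityAbove x q)
    if e then return true else exists D′ (lowerBoundAbove x q)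
  bounded D′ _ = return false

  answer : List Constraint → Constraint → Timed Bool
  answer D′ β = do
    inconsistent ← ⊥ᶜ ∈? D′
    derived      ← β ∈? D′
    if inconsistent ∨ derived then return true else bounded D′ β

  data State : Set where
    input      : State
    saturating : List Constraint → State
    returned   : Bool → State

  -- The algorithm on input ⋀D → β.  The order in which the applications of one
  -- rule are carried out is left open, hence a relation.
  data Step (D : List Constraint) (β : Constraint) : State → ℕ → State → Set where

    load : Step D β input (suc (size D β)) (saturating (map represent D))

    derive : ∀ {E c} → let new = candidates (concatMap vars (β ∷ D)) E in
             c ∈ value new →
             Step D β (saturating E) (suc (time new)) (saturating (c ∷ E))

    finish : ∀ {E} → let new = candidates (concatMap vars (β ∷ D)) E
                         ans = answer E (represent β) in
             value new ≡ [] →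
             Step D β (saturating E) (suc (time new ℕ.+ time ans)) (returned (value ans))

  data Run (D : List Constraint) (β : Constraint) : ℕ → State → Set where
    start : Run D β 0 input
    _then_ : ∀ {t u s s′} → Run D β t s → Step D β s u s′ → Run D β (t ℕ.+ u) s′

  record TerminatesWithin (D : List Constraint) (β : Constraint) (T : ℕ) : Set where
    field
      noInfiniteRun : Acc (λ s′ s → ∃ λ u → Step D β s u s′) input
      neverStuck    : ∀ {t s} → Run D β t s →
                      (∃ λ b → s ≡ returned b) ⊎ (∃₂ λ u s′ → Step D β s u s′)
      timeBound     : ∀ {t s} → Run D β t s → t ≤ T

  Decides : List Constraint → Constraint → Set
  Decides D β = ∀ {t b} → Run D β t (returned b) → (b ≡ true) ⇔ (D ⊨ β)

{-# OPTIONS --safe #-}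
-- Completeness.  If a saturated set without ⊥ contains no constraint that makes the algorithm
-- answer true, then β fails in some model.  A variable with x ≐ q takes the value q; any other
-- one takes max ({- q ∣ x ⊕ q ≐ y} ∪ {p ∣ x ≻ p}) + 1, which moves by p along every x ⊕ p ≐ y.
-- The component of one variable without a value may moreover be moved freely above its lower
-- bounds, and all variables with a value lie in a single component by R₋; this is enough to falsify β.
--
-- Number of steps.  As the rules deriving ⊥ come first, the other rules only apply to sets with at
-- most one x ≐ q for each x and one x ⊕ q ≐ y for each x, y.  As R₊ precedes R>, every derived lower
-- bound on y is an input bound x ≻ q shifted along the link x ⊕ p ≐ y, so there is one for each
-- x ≻ q and y.
--
-- Size of the numbers.  All rationals are integral multiples of 1 / L, where L is the product of the
-- denominators of the input, and each step at most doubles the largest numerator.  Chains of R₊ may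
-- really produce numerators exponential in the input while an inconsistency is still undetected,
-- but their bit lengths stay polynomial because the number of steps is.
module Submission where

open import Defs
open import Data.Bool using (Bool; true; false; if_then_else_; not; _∧_; _∨_)
open import Data.Empty using (⊥-elim)
open import Data.Integer using (ℤ; +_; ∣_∣)
import Data.Integer as ℤ
import Data.Integer.Properties as ℤ
open import Data.Integer.Solver using () renaming (module +-*-Solver to ℤ-Solver)
open import Data.List using (List; []; _∷_; [_]; _++_; length; map; concatMap; cartesianProductWith)
open import Data.List.Membership.Propositional using (_∈_; _∉_; find; lose)
open import Data.List.Membership.Propositional.Properties
open import Data.List.Properties using (length-++; length-map)
open import Data.List.Relation.Binary.Subset.Propositional using (_⊆_)
open import Data.List.Relation.Unary.All as All using (All; []; _∷_)
import Data.List.Relation.Unary.All.Properties as All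
open import Data.List.Relation.Unary.AllPairs using ([]; _∷_)
open import Data.List.Relation.Unary.Any as Any using (here; there)
open import Data.List.Relation.Unary.Unique.Propositional using (Unique)
open import Data.Nat using (ℕ; zero; suc; _+_; _*_; _^_; _≤_; _<_; z≤n; s≤s)
import Data.Nat as ℕ
open import Data.Nat.Coprimality as Coprimality using (coprime-divisor)
open import Data.Nat.Divisibility using (_∣_; divides; ∣⇒≤)
open import Data.Nat.ListAction using (sum; product)
open import Data.Nat.ListAction.Properties using (∈⇒∣product; product≢0)
open import Data.Nat.Logarithm using (⌊log₂_⌋; ⌊log₂⌋-mono-≤; ⌊log₂[2^n]⌋≡n)
import Data.Nat.Properties as ℕ
open import Data.Nat.Solver using () renaming (module +-*-Solver to ℕ-Solver)
open import Data.Product using (∃; ∃₂; ∃-syntax; _×_; _,_; proj₁; proj₂)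
open import Data.Rational using (ℚ; mkℚ; 0ℚ; 1ℚ; ↥_; ↧_; ↧ₙ_; toℚᵘ)
import Data.Rational as ℚ
import Data.Rational.Properties as ℚ
open import Data.Rational.Solver using () renaming (module +-*-Solver to ℚ-Solver)
open import Data.Rational.Unnormalised using (mkℚᵘ; *≡*)
import Data.Rational.Unnormalised as ℚᵘ
import Data.Rational.Unnormalised.Properties as ℚᵘ
open import Data.Sum using (_⊎_; inj₁; inj₂)
open import Data.Unit using (tt)
open import Function using (_∘_)
open import Function.Bundles using (_⇔_; mk⇔)
open import Induction.WellFounded using (Acc; acc)
open import Relation.Binary.Bundles using (module DecTotalOrder)
open import Relation.Binary.PropositionalEquality using (_≡_; _≢_; refl; sym; trans; cong; cong₂; subst; subst₂; module ≡-Reasoning)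
open import Relation.Nullary using (¬_; Dec; yes; no; does; contradiction)
open import Relation.Nullary.Decidable using (dec-true; dec-false; map′; _×-dec_)
open import Data.List.Extrema (DecTotalOrder.totalOrder ℚ.≤-decTotalOrder) using (max; xs≤max; ⊥≤max; argmax-sel)

-- Bit lengths and polynomial bounds

n<2^bits : ∀ n → n < 2 ^ bits n
n<2^bits n = ℕ.≰⇒> λ 2^b≤n → ℕ.<-irrefl refl
  (subst (_≤ ⌊log₂ n ⌋) (⌊log₂[2^n]⌋≡n (bits n)) (⌊log₂⌋-mono-≤ 2^b≤n))

bits≤ : ∀ {n k} → n ≤ 2 ^ k → bits n ≤ suc k
bits≤ {n} {k} n≤2^k = s≤s (subst (⌊log₂ n ⌋ ≤_) (⌊log₂[2^n]⌋≡n k) (⌊log₂⌋-mono-≤ n≤2^k))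

^-distribʳ-* : ∀ k m n → (m * n) ^ k ≡ m ^ k * n ^ k
^-distribʳ-* zero    m n = refl
^-distribʳ-* (suc k) m n = trans (cong (m * n *_) (^-distribʳ-* k m n))
  (solve 4 (λ m n a b → m :* n :* (a :* b) := m :* a :* (n :* b)) refl m n (m ^ k) (n ^ k))
  where open ℕ-Solver

-- Unlike c * n ^ k + c, a bound of the form c * suc n ^ k is stable under products on the nose.
Poly : (ℕ → ℕ) → Set
Poly f = ∃₂ λ c k → ∀ n → f n ≤ c * suc n ^ k

-- For positive `n`, `suc n ≤ 2 * n` moves a factor `2 ^ k` into the constant. At `n = 0`, where
-- `0 ^ k` may vanish, the additive constant covers the value.
Poly⇒PolynomiallyBounded : ∀ {f} → Poly f → PolynomiallyBounded f
Poly⇒PolynomiallyBounded {f} (c , k , f≤) = c * 2 ^ k , k , λ n → ℕ.≤-trans (f≤ n) (bound n)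
  where
  open ℕ.≤-Reasoning
  bound : ∀ n → c * suc n ^ k ≤ c * 2 ^ k * n ^ k + c * 2 ^ k
  bound zero = begin
    c * 1 ^ k                      ≤⟨ ℕ.*-monoʳ-≤ c (ℕ.^-monoˡ-≤ k (s≤s z≤n)) ⟩
    c * 2 ^ k                      ≤⟨ ℕ.m≤n+m _ _ ⟩
    c * 2 ^ k * 0 ^ k + c * 2 ^ k  ∎
  bound n@(suc m) = begin
    c * suc n ^ k                  ≤⟨ ℕ.*-monoʳ-≤ c (ℕ.^-monoˡ-≤ k (s≤s (ℕ.≤-trans (ℕ.m≤n+m n m) (ℕ.+-monoʳ-≤ m (ℕ.m≤m+n n 0))))) ⟩
    c * (2 * n) ^ k                ≡⟨ cong (c *_) (^-distribʳ-* k 2 n) ⟩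
    c * (2 ^ k * n ^ k)            ≡⟨ ℕ.*-assoc c (2 ^ k) (n ^ k) ⟨
    c * 2 ^ k * n ^ k              ≤⟨ ℕ.m≤m+n _ _ ⟩
    c * 2 ^ k * n ^ k + c * 2 ^ k  ∎

poly-const : ∀ m → Poly (λ _ → m)
poly-const m = m , 0 , λ _ → ℕ.≤-reflexive (sym (ℕ.*-identityʳ m))

poly-id : Poly (λ n → n)
poly-id = 1 , 1 , λ n → ℕ.≤-trans (ℕ.n≤1+n n)
  (ℕ.≤-reflexive (sym (trans (ℕ.*-identityˡ _) (ℕ.*-identityʳ _))))

suc^-mono : ∀ n {k l} → k ≤ l → suc n ^ k ≤ suc n ^ l
suc^-mono n = ℕ.^-monoʳ-≤ (suc n)

poly-+ : ∀ {f g} → Poly f → Poly g → Poly (λ n → f n + g n)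
poly-+ {f} {g} (c , k , f≤) (d , l , g≤) = c + d , k + l , λ n → begin
  f n + g n                              ≤⟨ ℕ.+-mono-≤ (f≤ n) (g≤ n) ⟩
  c * suc n ^ k + d * suc n ^ l          ≤⟨ ℕ.+-mono-≤ (ℕ.*-monoʳ-≤ c (suc^-mono n (ℕ.m≤m+n k l)))
                                                        (ℕ.*-monoʳ-≤ d (suc^-mono n (ℕ.m≤n+m l k))) ⟩
  c * suc n ^ (k + l) + d * suc n ^ (k + l) ≡⟨ ℕ.*-distribʳ-+ (suc n ^ (k + l)) c d ⟨
  (c + d) * suc n ^ (k + l)              ∎
  where open ℕ.≤-Reasoning

poly-suc : ∀ {f} → Poly f → Poly (λ n → suc (f n))
poly-suc = poly-+ (poly-const 1)

poly-* : ∀ {f g} → Poly f → Poly g → Poly (λ n → f n * g n)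
poly-* {f} {g} (c , k , f≤) (d , l , g≤) = c * d , k + l , λ n → begin
  f n * g n                        ≤⟨ ℕ.*-mono-≤ (f≤ n) (g≤ n) ⟩
  c * suc n ^ k * (d * suc n ^ l)  ≡⟨ solve 4 (λ c d x y → c :* x :* (d :* y) := c :* d :* (x :* y)) refl
                                        c d (suc n ^ k) (suc n ^ l) ⟩
  c * d * (suc n ^ k * suc n ^ l)  ≡⟨ cong (c * d *_) (ℕ.^-distribˡ-+-* (suc n) k l) ⟨
  c * d * suc n ^ (k + l)          ∎
  where
  open ℕ.≤-Reasoning
  open ℕ-Solver

poly-^ : ∀ {f} k → Poly f → Poly (λ n → f n ^ k)
poly-^ zero    p = poly-const 1
poly-^ (suc k) p = poly-* p (poly-^ k p)

-- Rationals over a common denominator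

-- mkℚᵘ a d is the fraction a / suc d.
record Fraction (d M : ℕ) (q : ℚ) : Set where
  constructor fraction
  field
    numerator : ℤ
    equal     : toℚᵘ q ℚᵘ.≃ mkℚᵘ numerator d
    bounded   : ∣ numerator ∣ ≤ M

fraction-≤ : ∀ {d M N q} → M ≤ N → Fraction d M q → Fraction d N q
fraction-≤ M≤N (fraction a eq a≤M) = fraction a eq (ℕ.≤-trans a≤M M≤N)

fraction-0 : ∀ {d} M → Fraction d M 0ℚ
fraction-0 M = fraction (+ 0) (*≡* refl) z≤n

fraction-neg : ∀ {d M q} → Fraction d M q → Fraction d M (ℚ.- q)
fraction-neg {q = q} (fraction a eq a≤M) = fraction (ℤ.- a)
  (ℚᵘ.≃-trans (ℚ.toℚᵘ-homo‿- q) (ℚᵘ.-‿cong eq)) (ℕ.≤-trans (ℕ.≤-reflexive (ℤ.∣-i∣≡∣i∣ a)) a≤M)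

-- Over a fixed denominator numerators simply add. This is why the growth of numerators is measured
-- before reduction to lowest terms.
fraction-+ : ∀ {d M N q p} → Fraction d M q → Fraction d N p → Fraction d (M + N) (q ℚ.+ p)
fraction-+ {d} {q = q} {p} (fraction a eq a≤M) (fraction b eq′ b≤N) = fraction (a ℤ.+ b)
  (ℚᵘ.≃-trans (ℚ.toℚᵘ-homo-+ q p) (ℚᵘ.≃-trans (ℚᵘ.+-cong eq eq′) common))
  (ℕ.≤-trans (ℤ.∣i+j∣≤∣i∣+∣j∣ a b) (ℕ.+-mono-≤ a≤M b≤N))
  where
  open ℤ-Solver
  common : mkℚᵘ a d ℚᵘ.+ mkℚᵘ b d ℚᵘ.≃ mkℚᵘ (a ℤ.+ b) d
  common = *≡* (trans
    (solve 3 (λ a b l → (a :* l :+ b :* l) :* l := (a :+ b) :* (l :* l)) refl a b (+ suc d))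
    (cong ((a ℤ.+ b) ℤ.*_) (sym (ℤ.pos-* (suc d) (suc d)))))

-- The reduced denominator divides the product of the reduced numerator and `suc d`, and it is
-- coprime to that numerator, so it divides `suc d`.
fraction-↧ : ∀ {d M q} → Fraction d M q → ↧ₙ q ≤ suc d
fraction-↧ {d} {q = mkℚ n e coprime} (fraction a (*≡* eq) _) = ∣⇒≤ (coprime-divisor
  (Coprimality.sym (Coprimality.recompute coprime))
  (divides ∣ a ∣ (trans (sym (ℤ.abs-* n (+ suc d))) (trans (cong ∣_∣ eq) (ℤ.abs-* a (+ suc e))))))

-- Reduction cannot enlarge the numerator: cross-multiply and use that the reduced denominator is at
-- most `suc d`.
fraction-↥ : ∀ {d M q} → Fraction d M q → ∣ ↥ q ∣ ≤ M
fraction-↥ {d} {M} {q@(mkℚ _ _ _)} f@(fraction a (*≡* eq) a≤M) = ℕ.≤-trans (ℕ.*-cancelʳ-≤ ∣ ↥ q ∣ ∣ a ∣ (suc d) (begin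
  ∣ ↥ q ∣ * suc d        ≡⟨ ℤ.abs-* (↥ q) (+ suc d) ⟨
  ∣ ↥ q ℤ.* + suc d ∣    ≡⟨ cong ∣_∣ eq ⟩
  ∣ a ℤ.* ↧ q ∣          ≡⟨ ℤ.abs-* a (↧ q) ⟩
  ∣ a ∣ * ↧ₙ q           ≤⟨ ℕ.*-monoʳ-≤ ∣ a ∣ (fraction-↧ f) ⟩
  ∣ a ∣ * suc d          ∎)) a≤M
  where open ℕ.≤-Reasoning

-- The fraction is expanded by the cofactor `m`, which is itself at most `suc d`.
↧∣⇒fraction : ∀ {d} q → ↧ₙ q ∣ suc d → Fraction d (∣ ↥ q ∣ * suc d) q
↧∣⇒fraction {d} q@(mkℚ n e _) (divides m eq) = fraction (n ℤ.* + m)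
  (*≡* (trans (cong (n ℤ.*_) (trans (cong +_ eq) (ℤ.pos-* m (suc e)))) (sym (ℤ.*-assoc n (+ m) (+ suc e)))))
  (ℕ.≤-trans (ℕ.≤-reflexive (ℤ.abs-* n (+ m)))
    (ℕ.*-monoʳ-≤ ∣ n ∣ (ℕ.≤-trans (ℕ.m≤m*n m (suc e)) (ℕ.≤-reflexive (sym eq)))))

bitsℚ≤ : ∀ {d k l q} → suc d ≤ 2 ^ l → Fraction d (2 ^ k) q → bitsℚ q ≤ suc (suc k + suc l)
bitsℚ≤ d<2^l f = s≤s (ℕ.+-mono-≤ (bits≤ (fraction-↥ f)) (bits≤ (ℕ.≤-trans (fraction-↧ f) d<2^l)))

-- Members, lengths and running times of the timed list operations

module _ {A B : Set} {f : A → Timed (List B)} where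

  ∈-forEach⁻ : ∀ as {b} → b ∈ value (forEach as f) → ∃[ a ] a ∈ as × b ∈ value (f a)
  ∈-forEach⁻ (a ∷ as) b∈ with ∈-++⁻ (value (f a)) b∈
  ... | inj₁ b∈fa = a , here refl , b∈fa
  ... | inj₂ b∈as = let a′ , a′∈as , b∈fa′ = ∈-forEach⁻ as b∈as in a′ , there a′∈as , b∈fa′

  ∈-forEach⁺ : ∀ {as a b} → a ∈ as → b ∈ value (f a) → b ∈ value (forEach as f)
  ∈-forEach⁺ (here refl)             b∈ = ∈-++⁺ˡ b∈
  ∈-forEach⁺ {a ∷ _} (there a′∈as) b∈ = ∈-++⁺ʳ (value (f a)) (∈-forEach⁺ a′∈as b∈)

  length-forEach : ∀ {l} as → (∀ {a} → a ∈ as → length (value (f a)) ≤ l) →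
    length (value (forEach as f)) ≤ length as * l
  length-forEach []       _   = z≤n
  length-forEach (a ∷ as) f≤l = ℕ.≤-trans (ℕ.≤-reflexive (length-++ (value (f a))))
    (ℕ.+-mono-≤ (f≤l (here refl)) (length-forEach as (f≤l ∘ there)))

  -- The summand `suc l` pays for appending the output of one element. Appending is linear in its
  -- left list, here the output of the first element, so the total is linear in `length as`.
  time-forEach : ∀ {t l} as → (∀ {a} → a ∈ as → time (f a) ≤ t) →
    (∀ {a} → a ∈ as → length (value (f a)) ≤ l) → time (forEach as f) ≤ suc (length as * (t + suc l))
  time-forEach []       _   _   = s≤s z≤n
  time-forEach {t} {l} (a ∷ as) f≤t f≤l = begin
    time (f a) + (time (forEach as f) + suc (length (value (f a))))
      ≤⟨ ℕ.+-mono-≤ (f≤t (here refl)) (ℕ.+-mono-≤ (time-forEach as (f≤t ∘ there) (f≤l ∘ there)) (s≤s (f≤l (here refl)))) ⟩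
    t + (suc (length as * (t + suc l)) + suc l)
      ≡⟨ solve 3 (λ t l n → t :+ (con 1 :+ n :+ l) := con 1 :+ (t :+ l :+ n)) refl t (suc l) (length as * (t + suc l)) ⟩
    suc (length (a ∷ as) * (t + suc l)) ∎
    where
    open ℕ.≤-Reasoning
    open ℕ-Solver

module _ {A : Set} {f : A → Timed Bool} where

  exists⁻ : ∀ as → value (exists as f) ≡ true → ∃[ a ] a ∈ as × value (f a) ≡ true
  exists⁻ (a ∷ as) eq with value (f a) in fa
  ... | true  = a , here refl , fa
  ... | false = let a′ , a′∈as , fa′ = exists⁻ as eq in a′ , there a′∈as , fa′

  exists⁺ : ∀ {as a} → a ∈ as → value (f a) ≡ true → value (exists as f) ≡ true
  exists⁺ (here refl) fa rewrite fa = refl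
  exists⁺ {a ∷ _} (there a′∈as) fa′ with value (f a)
  ... | true  = refl
  ... | false = exists⁺ a′∈as fa′

  time-exists : ∀ {t} as → (∀ {a} → a ∈ as → time (f a) ≤ t) → time (exists as f) ≤ suc (length as * suc t)
  time-exists []       _   = s≤s z≤n
  time-exists {t} (a ∷ as) f≤t = s≤s (ℕ.≤-trans (ℕ.+-mono-≤ (f≤t (here refl)) rest)
    (ℕ.≤-reflexive (ℕ.+-suc t _)))
    where
    rest : time (if value (f a) then return true else exists as f) ≤ suc (length as * suc t)
    rest with value (f a)
    ... | true  = z≤n
    ... | false = time-exists as (f≤t ∘ there)

-- Counting and Boolean reflection

length-cartesianProductWith : ∀ {A B C : Set} (f : A → B → C) as bs →
  length (cartesianProductWith f as bs) ≡ length as * length bs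
length-cartesianProductWith f []       bs = refl
length-cartesianProductWith f (a ∷ as) bs = trans (length-++ (map (f a) bs))
  (cong₂ _+_ (length-map (f a) bs) (length-cartesianProductWith f as bs))

-- Pigeonhole principle. One occurrence of the head of `as` is cut out of `bs`; the other entries of
-- `as` differ from it and so still lie in what remains.
unique-length : ∀ {A : Set} {as bs : List A} → Unique as → as ⊆ bs → length as ≤ length bs
unique-length []          _      = z≤n
unique-length {as = a ∷ as} (a≢as ∷ uniq) as⊆bs with ∈-∃++ (as⊆bs (here refl))
... | bs₁ , bs₂ , refl = ℕ.≤-trans (s≤s (unique-length uniq as⊆))
  (ℕ.≤-reflexive (trans (cong suc (length-++ bs₁)) (trans (sym (ℕ.+-suc _ _)) (sym (length-++ bs₁)))))
  where
  as⊆ : as ⊆ bs₁ ++ bs₂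
  as⊆ c∈as with ∈-++⁻ bs₁ (as⊆bs (there c∈as))
  ... | inj₁ c∈bs₁        = ∈-++⁺ˡ c∈bs₁
  ... | inj₂ (here refl)  = contradiction refl (All.lookup a≢as c∈as)
  ... | inj₂ (there c∈bs₂) = ∈-++⁺ʳ bs₁ c∈bs₂

does-true : ∀ {A : Set} (a? : Dec A) → does a? ≡ true → A
does-true (yes a) _ = a

∧-true : ∀ {a b} → a ∧ b ≡ true → a ≡ true × b ≡ true
∧-true {true} {true} _ = refl , refl

not-true : ∀ {b} → not b ≡ true → b ≡ false
not-true {false} _ = refl

if-[]⁻ : ∀ {A : Set} {b} {a a′ : A} → a ∈ (if b then [ a′ ] else []) → b ≡ true × a ≡ a′
if-[]⁻ {b = true} (here eq) = refl , eq

if-[]⁺ : ∀ {A : Set} {b} {a : A} → b ≡ true → a ∈ (if b then [ a ] else [])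
if-[]⁺ refl = here refl

does-false : ∀ {A : Set} (a? : Dec A) → does a? ≡ false → ¬ A
does-false (no ¬a) _ = ¬a

-- The saturation rules as a relation

data Rule : Set where
  r≠ r≠⁺ r< r- r↔ r₀ r+ r= r> : Rule

-- Side conditions appear as propositions, so that soundness, scope and growth are proved by cases
-- on inferences instead of on Boolean programs.
data Inference (xs : List Var) (E : List Constraint) : Rule → Constraint → Set where
  by-≠     : ∀ {x q p} → x ≐ q ∈ E → x ≐ p ∈ E → q ≢ p → Inference xs E r≠ ⊥ᶜ
  by-≠⁺    : ∀ {x q p y} → x ⊕ q ≐ y ∈ E → x ⊕ p ≐ y ∈ E → q ≢ p → Inference xs E r≠⁺ ⊥ᶜ
  by-<     : ∀ {x q p} → x ≐ q ∈ E → x ≻ p ∈ E → q ℚ.≤ p → Inference xs E r< ⊥ᶜ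
  by-minus : ∀ {x q y p} → x ≐ q ∈ E → y ≐ p ∈ E → Inference xs E r- (x ⊕ p ℚ.- q ≐ y)
  by-↔     : ∀ {x q y} → x ⊕ q ≐ y ∈ E → Inference xs E r↔ (y ⊕ ℚ.- q ≐ x)
  by-₀     : ∀ {x} → x ∈ xs → Inference xs E r₀ (x ⊕ 0ℚ ≐ x)
  by-+     : ∀ {x q y p z} → x ⊕ q ≐ y ∈ E → y ⊕ p ≐ z ∈ E → Inference xs E r+ (x ⊕ q ℚ.+ p ≐ z)
  by-=     : ∀ {x q p y} → x ≐ q ∈ E → x ⊕ p ≐ y ∈ E → Inference xs E r= (y ≐ q ℚ.+ p)
  by->     : ∀ {x q p y} → x ≻ q ∈ E → x ⊕ p ≐ y ∈ E → Inference xs E r> (y ≻ q ℚ.+ p)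

ClosedUnder : List Var → List Constraint → Rule → Set
ClosedUnder xs E r = ∀ {c} → Inference xs E r c → c ∈ E

-- A new conclusion is kept together with the fact that all rules of higher priority are exhausted.
-- The bound on the number of steps depends on this record.
data Fires (xs : List Var) (E : List Constraint) (c : Constraint) : List Rule → Set where
  now   : ∀ {r rs} → Inference xs E r c → c ∉ E → Fires xs E c (r ∷ rs)
  later : ∀ {r rs} → ClosedUnder xs E r → Fires xs E c rs → Fires xs E c (r ∷ rs)

byPriority : List Rule
byPriority = r≠ ∷ r≠⁺ ∷ r< ∷ r- ∷ r↔ ∷ r₀ ∷ r+ ∷ r= ∷ r> ∷ []

∈-byPriority : ∀ r → r ∈ byPriority
∈-byPriority r≠  = here refl
∈-byPriority r≠⁺ = there (here refl)
∈-byPriority r<  = there (there (here refl))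
∈-byPriority r-  = there (there (there (here refl)))
∈-byPriority r↔  = there (there (there (there (here refl))))
∈-byPriority r₀  = there (there (there (there (there (here refl)))))
∈-byPriority r+  = there (there (there (there (there (there (here refl))))))
∈-byPriority r=  = there (there (there (there (there (there (there (here refl)))))))
∈-byPriority r>  = there (there (there (there (there (there (there (there (here refl))))))))

data ≐-≐ : Constraint → Constraint → Set where
  mk : ∀ x q y p → ≐-≐ (x ≐ q) (y ≐ p)

data ⊕-⊕ : Constraint → Constraint → Set where
  mk : ∀ x q y x′ p y′ → ⊕-⊕ (x ⊕ q ≐ y) (x′ ⊕ p ≐ y′)

data ≐-≻ : Constraint → Constraint → Set where
  mk : ∀ x q y p → ≐-≻ (x ≐ q) (y ≻ p)

data ≐-⊕ : Constraint → Constraint → Set where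
  mk : ∀ x q x′ p y → ≐-⊕ (x ≐ q) (x′ ⊕ p ≐ y)

data ≻-⊕ : Constraint → Constraint → Set where
  mk : ∀ x q x′ p y → ≻-⊕ (x ≻ q) (x′ ⊕ p ≐ y)

-- The timed rules compute exactly the inferences

module Rules (κ : ℕ → ℕ) where

  open Algorithm κ public

  PairRule : Set
  PairRule = Constraint → Constraint → Timed (List Constraint)

  -- Reduces all combinations of two constraints to the one shape on which a rule can act. The
  -- equation in `idle` also records that the other combinations take no time, so the same views
  -- serve for the cost analysis.
  data View (Shape : Constraint → Constraint → Set) (R : PairRule) (a b : Constraint) : Set where
    idle   : R a b ≡ return [] → View Shape R a b
    active : Shape a b → View Shape R a b

  view-≠ : ∀ a b → View ≐-≐ R≠ a b
  view-≠ (⊤ᶜ _)      _           = idle refl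
  view-≠ ⊥ᶜ          _           = idle refl
  view-≠ (_ ≻ _)     _           = idle refl
  view-≠ (_ ⊕ _ ≐ _) _           = idle refl
  view-≠ (_ ≐ _)     (⊤ᶜ _)      = idle refl
  view-≠ (_ ≐ _)     ⊥ᶜ          = idle refl
  view-≠ (x ≐ q)     (y ≐ p)     = active (mk x q y p)
  view-≠ (_ ≐ _)     (_ ≻ _)     = idle refl
  view-≠ (_ ≐ _)     (_ ⊕ _ ≐ _) = idle refl

  view-≠⁺ : ∀ a b → View ⊕-⊕ R≠⁺ a b
  view-≠⁺ (⊤ᶜ _)      _              = idle refl
  view-≠⁺ ⊥ᶜ          _              = idle refl
  view-≠⁺ (_ ≐ _)     _              = idle refl
  view-≠⁺ (_ ≻ _)     _              = idle refl
  view-≠⁺ (_ ⊕ _ ≐ _) (⊤ᶜ _)         = idle refl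
  view-≠⁺ (_ ⊕ _ ≐ _) ⊥ᶜ             = idle refl
  view-≠⁺ (_ ⊕ _ ≐ _) (_ ≐ _)        = idle refl
  view-≠⁺ (_ ⊕ _ ≐ _) (_ ≻ _)        = idle refl
  view-≠⁺ (x ⊕ q ≐ y) (x′ ⊕ p ≐ y′)  = active (mk x q y x′ p y′)

  view-< : ∀ a b → View ≐-≻ R< a b
  view-< (⊤ᶜ _)      _           = idle refl
  view-< ⊥ᶜ          _           = idle refl
  view-< (_ ≻ _)     _           = idle refl
  view-< (_ ⊕ _ ≐ _) _           = idle refl
  view-< (_ ≐ _)     (⊤ᶜ _)      = idle refl
  view-< (_ ≐ _)     ⊥ᶜ          = idle refl
  view-< (_ ≐ _)     (_ ≐ _)     = idle refl
  view-< (x ≐ q)     (y ≻ p)     = active (mk x q y p)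
  view-< (_ ≐ _)     (_ ⊕ _ ≐ _) = idle refl

  view-minus : ∀ a b → View ≐-≐ R- a b
  view-minus (⊤ᶜ _)      _           = idle refl
  view-minus ⊥ᶜ          _           = idle refl
  view-minus (_ ≻ _)     _           = idle refl
  view-minus (_ ⊕ _ ≐ _) _           = idle refl
  view-minus (_ ≐ _)     (⊤ᶜ _)      = idle refl
  view-minus (_ ≐ _)     ⊥ᶜ          = idle refl
  view-minus (x ≐ q)     (y ≐ p)     = active (mk x q y p)
  view-minus (_ ≐ _)     (_ ≻ _)     = idle refl
  view-minus (_ ≐ _)     (_ ⊕ _ ≐ _) = idle refl

  view-+ : ∀ a b → View ⊕-⊕ R+ a b
  view-+ (⊤ᶜ _)      _              = idle refl
  view-+ ⊥ᶜ          _              = idle refl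
  view-+ (_ ≐ _)     _              = idle refl
  view-+ (_ ≻ _)     _              = idle refl
  view-+ (_ ⊕ _ ≐ _) (⊤ᶜ _)         = idle refl
  view-+ (_ ⊕ _ ≐ _) ⊥ᶜ             = idle refl
  view-+ (_ ⊕ _ ≐ _) (_ ≐ _)        = idle refl
  view-+ (_ ⊕ _ ≐ _) (_ ≻ _)        = idle refl
  view-+ (x ⊕ q ≐ y) (x′ ⊕ p ≐ y′)  = active (mk x q y x′ p y′)

  view-= : ∀ a b → View ≐-⊕ R= a b
  view-= (⊤ᶜ _)      _            = idle refl
  view-= ⊥ᶜ          _            = idle refl
  view-= (_ ≻ _)     _            = idle refl
  view-= (_ ⊕ _ ≐ _) _            = idle refl
  view-= (_ ≐ _)     (⊤ᶜ _)       = idle refl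
  view-= (_ ≐ _)     ⊥ᶜ           = idle refl
  view-= (_ ≐ _)     (_ ≐ _)      = idle refl
  view-= (_ ≐ _)     (_ ≻ _)      = idle refl
  view-= (x ≐ q)     (x′ ⊕ p ≐ y) = active (mk x q x′ p y)

  view-> : ∀ a b → View ≻-⊕ R> a b
  view-> (⊤ᶜ _)      _            = idle refl
  view-> ⊥ᶜ          _            = idle refl
  view-> (_ ≐ _)     _            = idle refl
  view-> (_ ⊕ _ ≐ _) _            = idle refl
  view-> (_ ≻ _)     (⊤ᶜ _)       = idle refl
  view-> (_ ≻ _)     ⊥ᶜ           = idle refl
  view-> (_ ≻ _)     (_ ≐ _)      = idle refl
  view-> (_ ≻ _)     (_ ≻ _)      = idle refl
  view-> (x ≻ q)     (x′ ⊕ p ≐ y) = active (mk x q x′ p y)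

  -- Indexing by rule names makes `rules xs` definitionally equal to
  -- `map (conclusions xs) byPriority`, which permits induction along the priority list.
  conclusions : List Var → Rule → List Constraint → Timed (List Constraint)
  conclusions xs r≠  = pairs R≠
  conclusions xs r≠⁺ = pairs R≠⁺
  conclusions xs r<  = pairs R<
  conclusions xs r-  = pairs R-
  conclusions xs r↔  = λ E → forEach E R↔
  conclusions xs r₀  = λ E → forEach xs R₀
  conclusions xs r+  = pairs R+
  conclusions xs r=  = pairs R=
  conclusions xs r>  = pairs R>

  ∈-pairs⁻ : ∀ {Shape} R → (∀ a b → View Shape R a b) → ∀ E {c} → c ∈ value (pairs R E) →
    ∃₂ λ a b → a ∈ E × b ∈ E × Shape a b × c ∈ value (R a b)
  ∈-pairs⁻ R view E c∈ with ∈-forEach⁻ E c∈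
  ... | a , a∈E , c∈a with ∈-forEach⁻ E c∈a
  ...   | b , b∈E , c∈ab with view a b
  ...     | active s = a , b , a∈E , b∈E , s , c∈ab
  ...     | idle eq rewrite eq = contradiction c∈ab λ ()

  ∈-pairs⁺ : ∀ R {E a b c} → a ∈ E → b ∈ E → c ∈ value (R a b) → c ∈ value (pairs R E)
  ∈-pairs⁺ R a∈E b∈E c∈ = ∈-forEach⁺ a∈E (∈-forEach⁺ b∈E c∈)

  ∈-conclusions⁻ : ∀ {xs} r {E c} → c ∈ value (conclusions xs r E) → Inference xs E r c
  ∈-conclusions⁻ r≠ {E} c∈ with ∈-pairs⁻ R≠ view-≠ E c∈
  ... | _ , _ , a∈E , b∈E , mk x q y p , c∈ab with if-[]⁻ c∈ab
  ...   | b , refl with ∧-true b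
  ...     | same , differ with does-true (x ℕ.≟ y) same
  ...       | refl = by-≠ a∈E b∈E (does-false (q ℚ.≟ p) (not-true differ))
  ∈-conclusions⁻ r≠⁺ {E} c∈ with ∈-pairs⁻ R≠⁺ view-≠⁺ E c∈
  ... | _ , _ , a∈E , b∈E , mk x q y x′ p y′ , c∈ab with if-[]⁻ c∈ab
  ...   | b , refl with ∧-true b
  ...     | sameˡ , b′ with ∧-true b′
  ...       | sameʳ , differ with does-true (x ℕ.≟ x′) sameˡ | does-true (y ℕ.≟ y′) sameʳ
  ...         | refl | refl = by-≠⁺ a∈E b∈E (does-false (q ℚ.≟ p) (not-true differ))
  ∈-conclusions⁻ r< {E} c∈ with ∈-pairs⁻ R< view-< E c∈
  ... | _ , _ , a∈E , b∈E , mk x q y p , c∈ab with if-[]⁻ c∈ab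
  ...   | b , refl with ∧-true b
  ...     | same , below with does-true (x ℕ.≟ y) same
  ...       | refl = by-< a∈E b∈E (does-true (q ℚ.≤? p) below)
  ∈-conclusions⁻ r- {E} c∈ with ∈-pairs⁻ R- view-minus E c∈
  ... | _ , _ , a∈E , b∈E , mk x q y p , here refl = by-minus a∈E b∈E
  ∈-conclusions⁻ r↔ {E} c∈ with ∈-forEach⁻ E c∈
  ... | x ⊕ q ≐ y , a∈E , here refl = by-↔ a∈E
  ∈-conclusions⁻ {xs} r₀ c∈ with ∈-forEach⁻ xs c∈
  ... | x , x∈xs , here refl = by-₀ x∈xs
  ∈-conclusions⁻ r+ {E} c∈ with ∈-pairs⁻ R+ view-+ E c∈
  ... | _ , _ , a∈E , b∈E , mk x q y x′ p y′ , c∈ab with if-[]⁻ c∈ab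
  ...   | same , refl with does-true (y ℕ.≟ x′) same
  ...     | refl = by-+ a∈E b∈E
  ∈-conclusions⁻ r= {E} c∈ with ∈-pairs⁻ R= view-= E c∈
  ... | _ , _ , a∈E , b∈E , mk x q x′ p y , c∈ab with if-[]⁻ c∈ab
  ...   | same , refl with does-true (x ℕ.≟ x′) same
  ...     | refl = by-= a∈E b∈E
  ∈-conclusions⁻ r> {E} c∈ with ∈-pairs⁻ R> view-> E c∈
  ... | _ , _ , a∈E , b∈E , mk x q x′ p y , c∈ab with if-[]⁻ c∈ab
  ...   | same , refl with does-true (x ℕ.≟ x′) same
  ...     | refl = by-> a∈E b∈E

  ∈-conclusions⁺ : ∀ {xs r E c} → Inference xs E r c → c ∈ value (conclusions xs r E)
  ∈-conclusions⁺ (by-≠ {x} {q} {p} a∈E b∈E q≢p) = ∈-pairs⁺ R≠ a∈E b∈E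
    (if-[]⁺ (cong₂ _∧_ (dec-true (x ℕ.≟ x) refl) (cong not (dec-false (q ℚ.≟ p) q≢p))))
  ∈-conclusions⁺ (by-≠⁺ {x} {q} {p} {y} a∈E b∈E q≢p) = ∈-pairs⁺ R≠⁺ a∈E b∈E
    (if-[]⁺ (cong₂ _∧_ (dec-true (x ℕ.≟ x) refl)
      (cong₂ _∧_ (dec-true (y ℕ.≟ y) refl) (cong not (dec-false (q ℚ.≟ p) q≢p)))))
  ∈-conclusions⁺ (by-< {x} {q} {p} a∈E b∈E q≤p) = ∈-pairs⁺ R< a∈E b∈E
    (if-[]⁺ (cong₂ _∧_ (dec-true (x ℕ.≟ x) refl) (dec-true (q ℚ.≤? p) q≤p)))
  ∈-conclusions⁺ (by-minus a∈E b∈E) = ∈-pairs⁺ R- a∈E b∈E (here refl)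
  ∈-conclusions⁺ (by-↔ a∈E)     = ∈-forEach⁺ a∈E (here refl)
  ∈-conclusions⁺ (by-₀ x∈xs)    = ∈-forEach⁺ x∈xs (here refl)
  ∈-conclusions⁺ (by-+ {y = y} a∈E b∈E) = ∈-pairs⁺ R+ a∈E b∈E (if-[]⁺ (dec-true (y ℕ.≟ y) refl))
  ∈-conclusions⁺ (by-= {x} a∈E b∈E)     = ∈-pairs⁺ R= a∈E b∈E (if-[]⁺ (dec-true (x ℕ.≟ x) refl))
  ∈-conclusions⁺ (by-> {x} a∈E b∈E)     = ∈-pairs⁺ R> a∈E b∈E (if-[]⁺ (dec-true (x ℕ.≟ x) refl))

  ∈?⁻ : ∀ {c} E → value (c ∈? E) ≡ true → c ∈ E
  ∈?⁻ {c} E eq with exists⁻ E eq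
  ... | d , d∈E , c≟d with does-true (c ≟ d) c≟d
  ...   | refl = d∈E

  ∈?⁺ : ∀ {c E} → c ∈ E → value (c ∈? E) ≡ true
  ∈?⁺ {c} c∈E = exists⁺ c∈E (dec-true (c ≟ c) refl)

  ∈?-false : ∀ {c} E → value (c ∈? E) ≡ false → c ∉ E
  ∈?-false E eq c∈E with trans (sym (∈?⁺ c∈E)) eq
  ... | ()

  ∈-notIn⁻ : ∀ {E} cs {c} → c ∈ value (notIn E cs) → c ∈ cs × c ∉ E
  ∈-notIn⁻ {E} cs c∈ with ∈-forEach⁻ cs c∈
  ... | d , d∈cs , c∈d with value (d ∈? E) in eq | c∈d
  ...   | false | here refl = d∈cs , ∈?-false E eq

  notIn≡[] : ∀ {E cs c} → value (notIn E cs) ≡ [] → c ∈ cs → c ∈ E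
  notIn≡[] {E} {cs} {c} eq c∈cs with value (c ∈? E) in c∈?E
  ... | true  = ∈?⁻ E c∈?E
  ... | false with subst (c ∈_) eq (∈-forEach⁺ c∈cs
    (subst (λ b → c ∈ (if b then [] else [ c ])) (sym c∈?E) (here refl)))
  ...   | ()

  firstNew⁻ : ∀ {xs} rs {E c} → c ∈ value (firstNew (map (conclusions xs) rs) E) → Fires xs E c rs
  firstNew⁻ {xs} (r ∷ rs) {E} c∈ with value (notIn E (value (conclusions xs r E))) in eq
  ... | [] = later (notIn≡[] eq ∘ ∈-conclusions⁺) (firstNew⁻ rs c∈)
  ... | d ∷ ds = now (∈-conclusions⁻ r (proj₁ new)) (proj₂ new)
    where new = ∈-notIn⁻ (value (conclusions xs r E)) (subst (_ ∈_) (sym eq) c∈)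

  firstNew≡[] : ∀ {xs} rs {E} → value (firstNew (map (conclusions xs) rs) E) ≡ [] →
    ∀ {r} → r ∈ rs → ClosedUnder xs E r
  firstNew≡[] {xs} (r ∷ rs) {E} none r∈ with value (notIn E (value (conclusions xs r E))) in eq | r∈
  ... | [] | here refl = notIn≡[] eq ∘ ∈-conclusions⁺
  ... | [] | there r∈rs = firstNew≡[] rs none r∈rs

  ∈-candidates⁻ : ∀ {xs} E {c} → c ∈ value (candidates xs E) → ⊥ᶜ ∉ E × Fires xs E c byPriority
  ∈-candidates⁻ E c∈ with value (⊥ᶜ ∈? E) in eq
  ... | false = ∈?-false E eq , firstNew⁻ byPriority c∈

  candidates≡[] : ∀ {xs} E → value (candidates xs E) ≡ [] →
    ⊥ᶜ ∈ E ⊎ (⊥ᶜ ∉ E × ∀ r → ClosedUnder xs E r)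
  candidates≡[] E none with value (⊥ᶜ ∈? E) in eq
  ... | true  = inj₁ (∈?⁻ E eq)
  ... | false = inj₂ (∈?-false E eq , λ r → firstNew≡[] byPriority none (∈-byPriority r))

-- Soundness of the rules

q+[p-q]≡p : ∀ q p → q ℚ.+ (p ℚ.- q) ≡ p
q+[p-q]≡p = solve 2 (λ q p → q :+ (p :- q) := p) refl
  where open ℚ-Solver

[q+p]-p≡q : ∀ q p → (q ℚ.+ p) ℚ.- p ≡ q
[q+p]-p≡q = solve 2 (λ q p → (q :+ p) :- p := q) refl
  where open ℚ-Solver

[q-p]+p≡q : ∀ q p → (q ℚ.- p) ℚ.+ p ≡ q
[q-p]+p≡q = solve 2 (λ q p → (q :- p) :+ p := q) refl
  where open ℚ-Solver

+-cancelˡ : ∀ r {q p} → r ℚ.+ q ≡ r ℚ.+ p → q ≡ p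
+-cancelˡ r {q} {p} eq = trans (sym (drop q)) (trans (cong (ℚ._- r) eq) (drop p))
  where
  drop : ∀ s → (r ℚ.+ s) ℚ.- r ≡ s
  drop s = trans (cong (ℚ._- r) (ℚ.+-comm r s)) ([q+p]-p≡q s r)

q<q+1 : ∀ q → q ℚ.< q ℚ.+ 1ℚ
q<q+1 q = subst (ℚ._< q ℚ.+ 1ℚ) (ℚ.+-identityʳ q) (ℚ.+-monoʳ-< q (ℚ.*<* (ℤ.+<+ (s≤s z≤n))))

_⊨ₑ_ : Assignment → List Constraint → Set
v ⊨ₑ E = ∀ {c} → c ∈ E → v satisfies c

inference-sound : ∀ {xs E r c v} → v ⊨ₑ E → Inference xs E r c → v satisfies c
inference-sound ⊨E (by-≠ x≐q x≐p q≢p) = q≢p (trans (sym (⊨E x≐q)) (⊨E x≐p))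
inference-sound {v = v} ⊨E (by-≠⁺ {x} x+q x+p q≢p) =
  q≢p (+-cancelˡ (v x) (trans (⊨E x+q) (sym (⊨E x+p))))
inference-sound ⊨E (by-< {p = p} x≐q x≻p q≤p) =
  ℚ.<-irrefl refl (ℚ.<-≤-trans (subst (p ℚ.<_) (⊨E x≐q) (⊨E x≻p)) q≤p)
inference-sound ⊨E (by-minus {q = q} {p = p} x≐q y≐p) =
  trans (cong (ℚ._+ (p ℚ.- q)) (⊨E x≐q)) (trans (q+[p-q]≡p q p) (sym (⊨E y≐p)))
inference-sound {v = v} ⊨E (by-↔ {x} {q} x+q) =
  trans (cong (ℚ._- q) (sym (⊨E x+q))) ([q+p]-p≡q (v x) q)
inference-sound {v = v} ⊨E (by-₀ {x} _) = ℚ.+-identityʳ (v x)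
inference-sound {v = v} ⊨E (by-+ {x} {q} {p = p} x+q y+p) =
  trans (sym (ℚ.+-assoc (v x) q p)) (trans (cong (ℚ._+ p) (⊨E x+q)) (⊨E y+p))
inference-sound ⊨E (by-= {p = p} x≐q x+p) = trans (sym (⊨E x+p)) (cong (ℚ._+ p) (⊨E x≐q))
inference-sound ⊨E (by-> {q = q} {p} x≻q x+p) =
  subst (q ℚ.+ p ℚ.<_) (⊨E x+p) (ℚ.+-monoˡ-< p (⊨E x≻q))

-- Searching a set of constraints, and the marks of a variable

search : ∀ {P : Constraint → Set} → (∀ c → Dec (P c)) → ∀ E → Dec (∃ λ c → c ∈ E × P c)
search P? E = map′ find (λ (_ , c∈E , Pc) → lose c∈E Pc) (Any.any? P? E)

valued? : ∀ E x → Dec (∃ λ q → x ≐ q ∈ E)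
valued? E x = map′ (λ { (_ , c∈E , q , refl) → q , c∈E }) (λ (q , c∈E) → _ , c∈E , q , refl) (search is? E)
  where
  is? : ∀ c → Dec (∃ λ q → c ≡ x ≐ q)
  is? (y ≐ q)     = map′ (λ { refl → q , refl }) (λ { (_ , refl) → refl }) (y ℕ.≟ x)
  is? (⊤ᶜ _)      = no λ ()
  is? ⊥ᶜ          = no λ ()
  is? (_ ≻ _)     = no λ ()
  is? (_ ⊕ _ ≐ _) = no λ ()

linked? : ∀ E x y → Dec (∃ λ q → x ⊕ q ≐ y ∈ E)
linked? E x y = map′ (λ { (_ , c∈E , q , refl) → q , c∈E }) (λ (q , c∈E) → _ , c∈E , q , refl) (search is? E)
  where
  is? : ∀ c → Dec (∃ λ q → c ≡ x ⊕ q ≐ y)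
  is? (x′ ⊕ q ≐ y′) = map′ (λ { (refl , refl) → q , refl }) (λ { (_ , refl) → refl , refl }) (x′ ℕ.≟ x ×-dec y′ ℕ.≟ y)
  is? (⊤ᶜ _)        = no λ ()
  is? ⊥ᶜ            = no λ ()
  is? (_ ≐ _)       = no λ ()
  is? (_ ≻ _)       = no λ ()

boundedBelow? : ∀ E x q → Dec (∃ λ p → x ≻ p ∈ E × q ℚ.≤ p)
boundedBelow? E x q = map′ (λ { (_ , c∈E , p , refl , q≤p) → p , c∈E , q≤p })
  (λ (p , c∈E , q≤p) → _ , c∈E , p , refl , q≤p) (search is? E)
  where
  is? : ∀ c → Dec (∃ λ p → c ≡ x ≻ p × q ℚ.≤ p)
  is? (y ≻ p)     = map′ (λ { (refl , q≤p) → p , refl , q≤p }) (λ { (_ , refl , q≤p) → refl , q≤p })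
                      (y ℕ.≟ x ×-dec q ℚ.≤? p)
  is? (⊤ᶜ _)      = no λ ()
  is? ⊥ᶜ          = no λ ()
  is? (_ ≐ _)     = no λ ()
  is? (_ ⊕ _ ≐ _) = no λ ()

-- An offset is the value that `x` would have if the variable linked to it were 0. Bounds make the
-- greatest mark respect the lower bounds; offsets provide marks also in components that have no
-- bounds.
data Mark (E : List Constraint) (x : Var) : ℚ → Set where
  offset : ∀ {q y} → x ⊕ q ≐ y ∈ E → Mark E x (ℚ.- q)
  bound  : ∀ {q} → x ≻ q ∈ E → Mark E x q

marksOf : Var → Constraint → List ℚ
marksOf x (y ⊕ q ≐ _) = if does (x ℕ.≟ y) then [ ℚ.- q ] else []
marksOf x (y ≻ q)     = if does (x ℕ.≟ y) then [ q ] else []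
marksOf x _           = []

marks : List Constraint → Var → List ℚ
marks E x = concatMap (marksOf x) E

∈-marks⁻ : ∀ {E x q} → q ∈ marks E x → Mark E x q
∈-marks⁻ {E} {x} q∈ with find (∈-concatMap⁻ (marksOf x) {xs = E} q∈)
... | y ⊕ q ≐ z , c∈E , q∈c with if-[]⁻ q∈c
...   | same , refl with does-true (x ℕ.≟ y) same
...     | refl = offset c∈E
∈-marks⁻ {E} {x} q∈ | y ≻ q , c∈E , q∈c with if-[]⁻ q∈c
...   | same , refl with does-true (x ℕ.≟ y) same
...     | refl = bound c∈E

∈-marks⁺ : ∀ {E x q} → Mark E x q → q ∈ marks E x
∈-marks⁺ {x = x} (offset c∈E) = ∈-concatMap⁺ (marksOf x) (lose c∈E (if-[]⁺ (dec-true (x ℕ.≟ x) refl)))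
∈-marks⁺ {x = x} (bound c∈E)  = ∈-concatMap⁺ (marksOf x) (lose c∈E (if-[]⁺ (dec-true (x ℕ.≟ x) refl)))

greatest : List ℚ → ℚ
-- As a peak, the default arises only for a variable without any lower bound and without any link
-- starting at it.
greatest []       = 0ℚ
greatest (q ∷ qs) = max q qs

≤greatest : ∀ {q qs} → q ∈ qs → q ℚ.≤ greatest qs
≤greatest {qs = q ∷ qs} (here refl)  = ⊥≤max q qs
≤greatest {qs = q ∷ qs} (there q′∈) = All.lookup (xs≤max q qs) q′∈

greatest∈ : ∀ {q qs} → q ∈ qs → greatest qs ∈ qs
greatest∈ {qs = q ∷ qs} _ with argmax-sel (λ p → p) q qs
... | inj₁ eq = here eq
... | inj₂ m∈ = there m∈

peak : List Constraint → Var → ℚ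
peak E x = greatest (marks E x)

-- Models of a saturated set, and completeness

module Saturated {xs E} (consistent : ⊥ᶜ ∉ E) (closed : ∀ r → ClosedUnder xs E r) where

  link-unique : ∀ {x q p y} → x ⊕ q ≐ y ∈ E → x ⊕ p ≐ y ∈ E → q ≡ p
  link-unique {q = q} {p} x+q x+p with q ℚ.≟ p
  ... | yes q≡p = q≡p
  ... | no q≢p  = contradiction (closed _ (by-≠⁺ x+q x+p q≢p)) consistent

  value-unique : ∀ {x q p} → x ≐ q ∈ E → x ≐ p ∈ E → q ≡ p
  value-unique {q = q} {p} x≐q x≐p with q ℚ.≟ p
  ... | yes q≡p = q≡p
  ... | no q≢p  = contradiction (closed _ (by-≠ x≐q x≐p q≢p)) consistent

  value-above : ∀ {x q p} → x ≐ q ∈ E → x ≻ p ∈ E → p ℚ.< q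
  value-above x≐q x≻p = ℚ.≰⇒> λ q≤p → consistent (closed _ (by-< x≐q x≻p q≤p))

  flip : ∀ {x q y} → x ⊕ q ≐ y ∈ E → y ⊕ ℚ.- q ≐ x ∈ E
  flip x+q = closed _ (by-↔ x+q)

  -- Bounds move along the link by R>. An offset moves by composing the reversed link with the link
  -- that gives the offset.
  shift-mark : ∀ {x p y q} → x ⊕ p ≐ y ∈ E → Mark E x q → Mark E y (q ℚ.+ p)
  shift-mark {p = p} x+p (bound x≻q) = bound (closed _ (by-> x≻q x+p))
  shift-mark {p = p} x+p (offset {q} x+q) = subst (Mark E _)
    (solve 2 (λ p q → :- (:- p :+ q) := :- q :+ p) refl p q) (offset (closed _ (by-+ (flip x+p) x+q)))
    where open ℚ-Solver

  -- The link itself gives `x` a mark, so the greatest mark of `x` is attained, and its shift is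
  -- among the marks of `y`.
  peak-≤ : ∀ {x p y} → x ⊕ p ≐ y ∈ E → peak E x ℚ.+ p ℚ.≤ peak E y
  peak-≤ {x} x+p = ≤greatest (∈-marks⁺ (shift-mark x+p (∈-marks⁻ (greatest∈ (∈-marks⁺ (offset x+p))))))

  -- The greatest mark of x moves along with x, so that no representatives of the linked
  -- components need to be chosen to define a model.
  peak-shift : ∀ {x p y} → x ⊕ p ≐ y ∈ E → peak E x ℚ.+ p ≡ peak E y
  peak-shift {x} {p} {y} x+p = ℚ.≤-antisym (peak-≤ x+p) (subst (ℚ._≤ peak E x ℚ.+ p)
    ([q-p]+p≡q (peak E y) p) (ℚ.+-monoˡ-≤ p (peak-≤ (flip x+p))))

  -- A partial assignment that is compatible with links, given values and lower bounds. Each one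
  -- extends to a model by the peaks. Completeness uses two of them: the given values alone, and the
  -- given values together with one component placed at will.
  record Anchoring : Set₁ where
    field
      At     : Var → ℚ → Set
      at?    : ∀ x → Dec (∃ (At x))
      unique : ∀ {x q p} → At x q → At x p → q ≡ p
      shift  : ∀ {x p y q} → x ⊕ p ≐ y ∈ E → At x q → At y (q ℚ.+ p)
      fixed  : ∀ {x q} → x ≐ q ∈ E → At x q
      above  : ∀ {x p q} → x ≻ p ∈ E → At x q → p ℚ.< q

  module Model (A : Anchoring) where

    open Anchoring A

    level : ∀ {x} → Dec (∃ (At x)) → ℚ
    level {x} (yes (q , _)) = q
    level {x} (no _)        = peak E x ℚ.+ 1ℚ

    model : Assignment
    model x = level (at? x)

    model-at : ∀ {x q} → At x q → model x ≡ q
    model-at {x} x-at-q with at? x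
    ... | yes (p , x-at-p) = unique x-at-p x-at-q
    ... | no free          = contradiction (_ , x-at-q) free

    model-free : ∀ {x} → ¬ ∃ (At x) → model x ≡ peak E x ℚ.+ 1ℚ
    model-free {x} free with at? x
    ... | yes anchored = contradiction anchored free
    ... | no _         = refl

    model⊨E : model ⊨ₑ E
    model⊨E {⊤ᶜ _}      _   = tt
    model⊨E {⊥ᶜ}        ⊥∈E = consistent ⊥∈E
    model⊨E {x ≐ q}     x≐q = model-at (fixed x≐q)
    model⊨E {x ≻ p}     x≻p with at? x
    ... | yes (_ , x-at-q) = above x≻p x-at-q
    -- The added `1ℚ` turns the weak inequality for the greatest mark into a strict one.
    ... | no _             = ℚ.≤-<-trans (≤greatest (∈-marks⁺ (bound x≻p))) (q<q+1 (peak E x))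
    model⊨E {x ⊕ p ≐ y} x+p with at? x
    ... | yes (_ , x-at-q) = sym (model-at (shift x+p x-at-q))
    -- Both ends are free, since an anchored `y` would anchor `x` along the reversed link. Hence
    -- both take peak values, which shift by `p`.
    ... | no free          = trans
      (solve 3 (λ m o p → (m :+ o) :+ p := (m :+ p) :+ o) refl (peak E x) 1ℚ p)
      (trans (cong (ℚ._+ 1ℚ) (peak-shift x+p))
        (sym (model-free λ (_ , y-at-q) → free (_ , shift (flip x+p) y-at-q))))
      where open ℚ-Solver

  open Model public

  given : Anchoring
  given = record
    { At     = λ x q → x ≐ q ∈ E
    ; at?    = valued? E
    ; unique = value-unique
    ; shift  = λ x+p x≐q → closed _ (by-= x≐q x+p)
    ; fixed  = λ x≐q → x≐q
    ; above  = λ x≻p x≐q → value-above x≐q x≻p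
    }

  module _ {o} (o∈xs : o ∈ xs) (free : ¬ ∃ λ q → o ≐ q ∈ E) {r} (above-bounds : ∀ {p} → o ≻ p ∈ E → p ℚ.< r) where

    -- The position that a link from `o` forces on `x` once `o` is placed at `r`.
    OnOrbit : Var → ℚ → Set
    OnOrbit x q = ∃ λ p → o ⊕ p ≐ x ∈ E × q ≡ r ℚ.+ p

    -- A value of a linked variable would travel back to `o` by R₌.
    unvalued : ∀ {x p} → o ⊕ p ≐ x ∈ E → ¬ ∃ λ q → x ≐ q ∈ E
    unvalued o+p (_ , x≐q) = free (_ , closed _ (by-= x≐q (flip o+p)))

    anchored : Anchoring
    anchored = record
      { At     = λ x q → x ≐ q ∈ E ⊎ OnOrbit x q
      ; at?    = at?
      ; unique = unique
      ; shift  = shift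
      ; fixed  = inj₁
      ; above  = above
      }
      where
      At : Var → ℚ → Set
      At x q = x ≐ q ∈ E ⊎ OnOrbit x q

      at? : ∀ x → Dec (∃ (At x))
      at? x with valued? E x | linked? E o x
      ... | yes (q , x≐q) | _             = yes (q , inj₁ x≐q)
      ... | no _          | yes (p , o+p) = yes (r ℚ.+ p , inj₂ (p , o+p , refl))
      ... | no ¬valued    | no ¬linked    = no λ where
        (q , inj₁ x≐q)           → ¬valued (q , x≐q)
        (_ , inj₂ (p , o+p , _)) → ¬linked (p , o+p)

      unique : ∀ {x q p} → At x q → At x p → q ≡ p
      unique (inj₁ x≐q) (inj₁ x≐p)                          = value-unique x≐q x≐p
      unique (inj₁ x≐q) (inj₂ (_ , o+p , _))                = contradiction (_ , x≐q) (unvalued o+p)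
      unique (inj₂ (_ , o+p , _)) (inj₁ x≐p)                = contradiction (_ , x≐p) (unvalued o+p)
      unique (inj₂ (_ , o+p , refl)) (inj₂ (_ , o+q , refl)) = cong (r ℚ.+_) (link-unique o+p o+q)

      shift : ∀ {x p y q} → x ⊕ p ≐ y ∈ E → At x q → At y (q ℚ.+ p)
      shift x+p (inj₁ x≐q)              = inj₁ (closed _ (by-= x≐q x+p))
      shift {p = p} x+p (inj₂ (s , o+s , refl)) = inj₂ (s ℚ.+ p , closed _ (by-+ o+s x+p) , ℚ.+-assoc r s p)

      above : ∀ {x p q} → x ≻ p ∈ E → At x q → p ℚ.< q
      above x≻p (inj₁ x≐q) = value-above x≐q x≻p
      -- The bound travels back along the reversed link to a bound of `o`, which lies below `r`.
      above {p = p} x≻p (inj₂ (s , o+s , refl)) = subst (ℚ._< r ℚ.+ s) ([q-p]+p≡q p s)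
        (ℚ.+-monoˡ-< s (above-bounds (closed _ (by-> x≻p (flip o+s)))))

    -- By R₀ the variable `o` belongs to its own component, with offset 0.
    anchored-o : model anchored o ≡ r
    anchored-o = model-at anchored (inj₂ (0ℚ , closed _ (by-₀ o∈xs) , sym (ℚ.+-identityʳ r)))

    -- Outside the component of `o` nothing depends on `r`. So `r` may be chosen afterwards, in
    -- terms of the values found there.
    anchored-unlinked : ∀ {y} → (¬ ∃ λ p → o ⊕ p ≐ y ∈ E) → model anchored y ≡ model given y
    anchored-unlinked {y} ¬linked = compare (valued? E y)
      where
      compare : Dec (∃ λ q → y ≐ q ∈ E) → model anchored y ≡ model given y
      compare (yes (_ , y≐q)) = trans (model-at anchored (inj₁ y≐q)) (sym (model-at given y≐q))
      compare (no ¬valued)    = trans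
        (model-free anchored λ where
          (q , inj₁ y≐q)           → ¬valued (q , y≐q)
          (_ , inj₂ (p , o+p , _)) → ¬linked (p , o+p))
        (sym (model-free given ¬valued))

  module _ {o} (o∈xs : o ∈ xs) (free : ¬ ∃ λ q → o ≐ q ∈ E) where

    -- With `exceeds`: for every `s` there is an admissible position of `o` that differs from `s`,
    -- so no single value of `o` can be entailed.
    above-peak : ∀ s {p} → o ≻ p ∈ E → p ℚ.< (peak E o ℚ.⊔ s) ℚ.+ 1ℚ
    above-peak s o≻p = ℚ.≤-<-trans (≤greatest (∈-marks⁺ (bound o≻p)))
      (ℚ.≤-<-trans (ℚ.p≤p⊔q (peak E o) s) (q<q+1 _))

    exceeds : ∀ s → (peak E o ℚ.⊔ s) ℚ.+ 1ℚ ≢ s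
    exceeds s eq = ℚ.<-irrefl (sym eq) (ℚ.≤-<-trans (ℚ.p≤q⊔p (peak E o) s) (q<q+1 _))

    avoid-value : ∀ q → ¬ (∀ v → v ⊨ₑ E → v o ≡ q)
    avoid-value q entailed = exceeds q (trans (sym (anchored-o o∈xs free (above-peak q)))
      (entailed _ (model⊨E (anchored o∈xs free (above-peak q)))))

    avoid-link : ∀ q {y} → (¬ ∃ λ p → o ⊕ p ≐ y ∈ E) → ¬ (∀ v → v ⊨ₑ E → v o ℚ.+ q ≡ v y)
    avoid-link q {y} ¬linked entailed = exceeds s (begin
      (peak E o ℚ.⊔ s) ℚ.+ 1ℚ  ≡⟨ anchored-o o∈xs free (above-peak s) ⟨
      v o                      ≡⟨ [q+p]-p≡q (v o) q ⟨
      (v o ℚ.+ q) ℚ.- q        ≡⟨ cong (ℚ._- q) (entailed v (model⊨E (anchored o∈xs free (above-peak s)))) ⟩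
      v y ℚ.- q                ≡⟨ cong (ℚ._- q) (anchored-unlinked o∈xs free (above-peak s) ¬linked) ⟩
      s                        ∎)
      where
      open ≡-Reasoning
      -- The only position of `o` that satisfies the link while `y` keeps its value from
      -- `model given`.
      s = model given y ℚ.- q
      v = model (anchored o∈xs free (above-peak s))

  data Detected : Constraint → Set where
    member   : ∀ {c} → represent c ∈ E → Detected c
    by-value : ∀ {x q p} → x ≐ p ∈ E → q ℚ.< p → Detected (x ≻ q)
    by-bound : ∀ {x q p} → x ≻ p ∈ E → q ℚ.≤ p → Detected (x ≻ q)

  complete : ∀ β → vars β ⊆ xs → (∀ v → v ⊨ₑ E → v satisfies β) → Detected β
  complete (⊤ᶜ x) β⊆xs entailed = member (closed _ (by-₀ (β⊆xs (here refl))))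
  complete ⊥ᶜ β⊆xs entailed = ⊥-elim (entailed _ (model⊨E given))
  complete (x ≐ q) β⊆xs entailed with valued? E x
  ... | yes (p , x≐p) = member (subst (λ p → x ≐ p ∈ E)
    (trans (sym (model-at given x≐p)) (entailed _ (model⊨E given))) x≐p)
  ... | no free = contradiction entailed (avoid-value (β⊆xs (here refl)) free q)
  complete (x ≻ q) β⊆xs entailed with valued? E x
  ... | yes (p , x≐p) = by-value x≐p (subst (q ℚ.<_) (model-at given x≐p) (entailed _ (model⊨E given)))
  ... | no free with boundedBelow? E x q
  ...   | yes (p , x≻p , q≤p) = by-bound x≻p q≤p
  -- All bounds of `x` lie below `q`, so `x` may be placed exactly at `q`, where the strict
  -- inequality fails.
  ...   | no ¬bounded = contradiction (entailed _ (model⊨E (anchored x∈xs free below)))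
    (ℚ.<-irrefl (sym (anchored-o x∈xs free below)))
    where
    x∈xs = β⊆xs (here refl)
    below : ∀ {p} → x ≻ p ∈ E → p ℚ.< q
    below x≻p = ℚ.≰⇒> λ q≤p → ¬bounded (_ , x≻p , q≤p)
  complete (x ⊕ q ≐ y) β⊆xs entailed with linked? E x y
  -- The present link and the entailed one hold in a common model, which forces `p` and `q` to
  -- agree.
  ... | yes (p , x+p) = member (subst (λ p → x ⊕ p ≐ y ∈ E)
    (+-cancelˡ (model given x) (trans (model⊨E given x+p) (sym (entailed _ (model⊨E given))))) x+p)
  ... | no ¬linked with valued? E x | valued? E y
  ...   | no free | _ = contradiction entailed (avoid-link (β⊆xs (here refl)) free q ¬linked)
  -- R₋ would have linked two variables with values.
  ...   | yes (_ , x≐p) | yes (_ , y≐r) = contradiction (_ , closed _ (by-minus x≐p y≐r)) ¬linked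
  -- Only `y` can be moved, so the entailed link is read backwards.
  ...   | yes _ | no free = ⊥-elim
    (avoid-link (β⊆xs (there (here refl))) free (ℚ.- q) (λ (_ , y+p) → ¬linked (_ , flip y+p))
      λ v ⊨E → trans (cong (ℚ._- q) (sym (entailed v ⊨E))) ([q+p]-p≡q (v x) q))

-- Keys for counting steps

-- The budget for the saturation: each step puts a further key to use, and keys remain in use when
-- constraints are added. `clash` pays for a step that creates two distinct values or links,
-- `bottom` for the derivation of ⊥ that must follow it.
data Key : Set where
  bottom clash : Key
  value-of     : Var → Key
  difference   : Var → Var → Key
  lower        : Constraint → Var → Key

data Used (E : List Constraint) : Key → Set where
  bottom     : ⊥ᶜ ∈ E → Used E bottom
  clash-≐    : ∀ {x q p} → x ≐ q ∈ E → x ≐ p ∈ E → q ≢ p → Used E clash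
  clash-⊕    : ∀ {x q p y} → x ⊕ q ≐ y ∈ E → x ⊕ p ≐ y ∈ E → q ≢ p → Used E clash
  value-of   : ∀ {x q} → x ≐ q ∈ E → Used E (value-of x)
  difference : ∀ {x q y} → x ⊕ q ≐ y ∈ E → Used E (difference x y)
  lower      : ∀ {x q p y} → x ⊕ p ≐ y ∈ E → y ≻ q ℚ.+ p ∈ E → Used E (lower (x ≻ q) y)

used-∷ : ∀ {c E k} → Used E k → Used (c ∷ E) k
used-∷ (bottom ⊥∈E)          = bottom (there ⊥∈E)
used-∷ (clash-≐ x≐q x≐p q≢p) = clash-≐ (there x≐q) (there x≐p) q≢p
used-∷ (clash-⊕ x+q x+p q≢p) = clash-⊕ (there x+q) (there x+p) q≢p
used-∷ (value-of x≐q)        = value-of (there x≐q)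
used-∷ (difference x+q)      = difference (there x+q)
used-∷ (lower x+p y≻)        = lower (there x+p) (there y≻)

-- Growth, scope and size of constraints

constants : Constraint → List ℚ
constants (⊤ᶜ _)      = []
constants ⊥ᶜ          = []
constants (_ ≐ q)     = [ q ]
constants (_ ≻ q)     = [ q ]
constants (_ ⊕ q ≐ _) = [ q ]

Tame : ℕ → ℕ → Constraint → Set
Tame d M c = ∀ {q} → q ∈ constants c → Fraction d M q

inference-tame : ∀ {xs E r c d M} → (∀ {b} → b ∈ E → Tame d M b) → Inference xs E r c → Tame d (M + M) c
inference-tame tame (by-minus x≐q y≐p) (here refl) =
  fraction-+ (tame y≐p (here refl)) (fraction-neg (tame x≐q (here refl)))
inference-tame tame (by-↔ x+q)     (here refl) = fraction-≤ (ℕ.m≤m+n _ _) (fraction-neg (tame x+q (here refl)))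
inference-tame tame (by-₀ _)       (here refl) = fraction-0 _
inference-tame tame (by-+ x+q y+p) (here refl) = fraction-+ (tame x+q (here refl)) (tame y+p (here refl))
inference-tame tame (by-= x≐q x+p) (here refl) = fraction-+ (tame x≐q (here refl)) (tame x+p (here refl))
inference-tame tame (by-> x≻q x+p) (here refl) = fraction-+ (tame x≻q (here refl)) (tame x+p (here refl))

inference-scope : ∀ {xs E r c} → (∀ {b} → b ∈ E → vars b ⊆ xs) → Inference xs E r c → vars c ⊆ xs
inference-scope scope (by-minus x≐q y≐p) (here refl)         = scope x≐q (here refl)
inference-scope scope (by-minus x≐q y≐p) (there (here refl)) = scope y≐p (here refl)
inference-scope scope (by-↔ x+q)     (here refl)         = scope x+q (there (here refl))
inference-scope scope (by-↔ x+q)     (there (here refl)) = scope x+q (here refl)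
inference-scope scope (by-₀ x∈xs)    (here refl)         = x∈xs
inference-scope scope (by-₀ x∈xs)    (there (here refl)) = x∈xs
inference-scope scope (by-+ x+q y+p) (here refl)         = scope x+q (here refl)
inference-scope scope (by-+ x+q y+p) (there (here refl)) = scope y+p (there (here refl))
inference-scope scope (by-= x≐q x+p) (here refl)         = scope x+p (there (here refl))
inference-scope scope (by-> x≻q x+p) (here refl)         = scope x+p (there (here refl))

fired : ∀ {xs E c rs} → Fires xs E c rs → (∃ λ r → Inference xs E r c) × c ∉ E
fired (now inf c∉E)   = (_ , inf) , c∉E
fired (later _ fires) = fired fires

bits-var : ∀ c {x} → x ∈ vars c → bits x ≤ sizeᶜ c
bits-var (⊤ᶜ x)      (here refl)         = ℕ.n≤1+n _
bits-var (x ≐ q)     (here refl)         = ℕ.m≤n⇒m≤1+n (ℕ.m≤m+n _ _)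
bits-var (x ≻ q)     (here refl)         = ℕ.m≤n⇒m≤1+n (ℕ.m≤m+n _ _)
bits-var (x ⊕ q ≐ y) (here refl)         = ℕ.m≤n⇒m≤1+n (ℕ.≤-trans (ℕ.m≤m+n _ _) (ℕ.m≤m+n _ _))
bits-var (x ⊕ q ≐ y) (there (here refl)) = ℕ.m≤n⇒m≤1+n (ℕ.m≤n+m _ (bits x + bitsℚ q))

bits-constant : ∀ c {q} → q ∈ constants c → bitsℚ q ≤ sizeᶜ c
bits-constant (x ≐ q)     (here refl) = ℕ.m≤n⇒m≤1+n (ℕ.m≤n+m _ (bits x))
bits-constant (x ≻ q)     (here refl) = ℕ.m≤n⇒m≤1+n (ℕ.m≤n+m _ (bits x))
bits-constant (x ⊕ q ≐ y) (here refl) = ℕ.m≤n⇒m≤1+n (ℕ.≤-trans (ℕ.m≤n+m _ (bits x)) (ℕ.m≤m+n _ _))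

size-tame : ∀ {s d k l} c → (∀ {x} → x ∈ vars c → bits x ≤ s) → suc d ≤ 2 ^ l → Tame d (2 ^ k) c →
  sizeᶜ c ≤ suc (s + suc (suc k + suc l) + s)
size-tame (⊤ᶜ x)      b d≤ tame = s≤s (ℕ.≤-trans (b (here refl)) (ℕ.m≤n+m _ _))
size-tame ⊥ᶜ          b d≤ tame = s≤s z≤n
size-tame (x ≐ q)     b d≤ tame =
  s≤s (ℕ.≤-trans (ℕ.+-mono-≤ (b (here refl)) (bitsℚ≤ d≤ (tame (here refl)))) (ℕ.m≤m+n _ _))
size-tame (x ≻ q)     b d≤ tame =
  s≤s (ℕ.≤-trans (ℕ.+-mono-≤ (b (here refl)) (bitsℚ≤ d≤ (tame (here refl)))) (ℕ.m≤m+n _ _))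
size-tame (x ⊕ q ≐ y) b d≤ tame =
  s≤s (ℕ.+-mono-≤ (ℕ.+-mono-≤ (b (here refl)) (bitsℚ≤ d≤ (tame (here refl)))) (b (there (here refl))))

sizeᶜ≥1 : ∀ c → 1 ≤ sizeᶜ c
sizeᶜ≥1 (⊤ᶜ _)      = s≤s z≤n
sizeᶜ≥1 ⊥ᶜ          = s≤s z≤n
sizeᶜ≥1 (_ ≐ _)     = s≤s z≤n
sizeᶜ≥1 (_ ≻ _)     = s≤s z≤n
sizeᶜ≥1 (_ ⊕ _ ≐ _) = s≤s z≤n

vars-length : ∀ c → length (vars c) ≤ sizeᶜ c
vars-length (⊤ᶜ _)      = s≤s z≤n
vars-length ⊥ᶜ          = z≤n
vars-length (_ ≐ _)     = s≤s z≤n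
vars-length (_ ≻ _)     = s≤s z≤n
vars-length (x ⊕ q ≐ y) = s≤s (ℕ.m≤n⇒m≤n+o (bits y) (ℕ.m≤n⇒m≤n+o (bitsℚ q) (s≤s z≤n)))

total : List Constraint → ℕ
total D = sum (map sizeᶜ D)

sizeᶜ≤total : ∀ {c D} → c ∈ D → sizeᶜ c ≤ total D
sizeᶜ≤total (here refl)         = ℕ.m≤m+n _ _
sizeᶜ≤total {D = d ∷ _} (there c∈D) = ℕ.≤-trans (sizeᶜ≤total c∈D) (ℕ.m≤n+m _ (sizeᶜ d))

length≤total : ∀ D → length D ≤ total D
length≤total []      = z≤n
length≤total (c ∷ D) = ℕ.+-mono-≤ (sizeᶜ≥1 c) (length≤total D)

vars-length≤total : ∀ D → length (concatMap vars D) ≤ total D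
vars-length≤total []      = z≤n
vars-length≤total (c ∷ D) = ℕ.≤-trans (ℕ.≤-reflexive (length-++ (vars c)))
  (ℕ.+-mono-≤ (vars-length c) (vars-length≤total D))

denominator : Constraint → ℕ
denominator (⊤ᶜ _)      = 1
denominator ⊥ᶜ          = 1
denominator (_ ≐ q)     = ↧ₙ q
denominator (_ ≻ q)     = ↧ₙ q
denominator (_ ⊕ q ≐ _) = ↧ₙ q

denominator≢0 : ∀ c → ℕ.NonZero (denominator c)
denominator≢0 (⊤ᶜ _)      = _
denominator≢0 ⊥ᶜ          = _
denominator≢0 (_ ≐ q)     = _
denominator≢0 (_ ≻ q)     = _
denominator≢0 (_ ⊕ q ≐ _) = _

denominator-constant : ∀ c {q} → q ∈ constants c → denominator c ≡ ↧ₙ q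
denominator-constant (_ ≐ _)     (here refl) = refl
denominator-constant (_ ≻ _)     (here refl) = refl
denominator-constant (_ ⊕ _ ≐ _) (here refl) = refl

↧<2^bitsℚ : ∀ q → ↧ₙ q < 2 ^ bitsℚ q
↧<2^bitsℚ q = ℕ.<-≤-trans (n<2^bits (↧ₙ q))
  (ℕ.^-monoʳ-≤ 2 {bits (↧ₙ q)} (ℕ.m≤n⇒m≤1+n (ℕ.m≤n+m _ (bits ∣ ↥ q ∣))))

↥<2^bitsℚ : ∀ q → ∣ ↥ q ∣ < 2 ^ bitsℚ q
↥<2^bitsℚ q = ℕ.<-≤-trans (n<2^bits ∣ ↥ q ∣) (ℕ.^-monoʳ-≤ 2 {bits ∣ ↥ q ∣} (ℕ.m≤n⇒m≤1+n (ℕ.m≤m+n _ (bits (↧ₙ q)))))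

1≤2^n : ∀ n → 1 ≤ 2 ^ n
1≤2^n n = ℕ.^-monoʳ-≤ 2 (z≤n {n})

denominator≤ : ∀ c → denominator c ≤ 2 ^ sizeᶜ c
denominator≤ (⊤ᶜ x)        = 1≤2^n (sizeᶜ (⊤ᶜ x))
denominator≤ ⊥ᶜ            = s≤s z≤n
denominator≤ c@(_ ≐ q)     = ℕ.≤-trans (ℕ.<⇒≤ (↧<2^bitsℚ q)) (ℕ.^-monoʳ-≤ 2 (bits-constant c (here refl)))
denominator≤ c@(_ ≻ q)     = ℕ.≤-trans (ℕ.<⇒≤ (↧<2^bitsℚ q)) (ℕ.^-monoʳ-≤ 2 (bits-constant c (here refl)))
denominator≤ c@(_ ⊕ q ≐ _) = ℕ.≤-trans (ℕ.<⇒≤ (↧<2^bitsℚ q)) (ℕ.^-monoʳ-≤ 2 (bits-constant c (here refl)))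

commonDenominator : List Constraint → ℕ
commonDenominator D = product (map denominator D)

-- Denominators multiply where sizes add, so the bit length of the product stays linear in the
-- input.
commonDenominator≤ : ∀ D → commonDenominator D ≤ 2 ^ total D
commonDenominator≤ []      = s≤s z≤n
commonDenominator≤ (c ∷ D) = ℕ.≤-trans (ℕ.*-mono-≤ (denominator≤ c) (commonDenominator≤ D))
  (ℕ.≤-reflexive (sym (ℕ.^-distribˡ-+-* 2 (sizeᶜ c) (total D))))

commonDenominator≢0 : ∀ D → ℕ.NonZero (commonDenominator D)
commonDenominator≢0 D = product≢0 (All.map⁺ (All.universal denominator≢0 D))

-- Replacing ⊤ by a trivial link

represent-sound : ∀ v c → v satisfies c → v satisfies represent c
represent-sound v (⊤ᶜ x)      _ = ℚ.+-identityʳ (v x)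
represent-sound v (_ ≐ _)     s = s
represent-sound v (_ ≻ _)     s = s
represent-sound v (_ ⊕ _ ≐ _) s = s

represent-complete : ∀ v c → v satisfies represent c → v satisfies c
represent-complete v (⊤ᶜ x)      _ = tt
represent-complete v (_ ≐ _)     s = s
represent-complete v (_ ≻ _)     s = s
represent-complete v (_ ⊕ _ ≐ _) s = s

vars-represent : ∀ c → vars (represent c) ⊆ vars c
vars-represent (⊤ᶜ x)      (here refl)         = here refl
vars-represent (⊤ᶜ x)      (there (here refl)) = here refl
vars-represent (_ ≐ _)     x∈                  = x∈
vars-represent (_ ≻ _)     x∈                  = x∈
vars-represent (_ ⊕ _ ≐ _) x∈                  = x∈

constants-represent : ∀ c {q} → q ∈ constants (represent c) → q ≡ 0ℚ ⊎ q ∈ constants c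
constants-represent (⊤ᶜ _)      (here refl) = inj₁ refl
constants-represent (_ ≐ _)     q∈          = inj₂ q∈
constants-represent (_ ≻ _)     q∈          = inj₂ q∈
constants-represent (_ ⊕ _ ≐ _) q∈          = inj₂ q∈

represent-≻ : ∀ c {x q} → x ≻ q ≡ represent c → x ≻ q ≡ c
represent-≻ (_ ≻ _) eq = eq

-- Invariants of the saturation

-- Counts the keys: `bottom` and `clash`, one for each variable, one for each pair of variables, and
-- one for each input constraint with a target variable.
maxSteps : ℕ → ℕ
maxSteps n = 2 + (n + (n * n + n * n))

module Invariants (D : List Constraint) (β : Constraint) where

  S : ℕ
  S = size D β

  xs : List Var
  xs = concatMap vars (β ∷ D)

  universe : List Key
  universe = bottom ∷ clash ∷ map value-of xs ++ (cartesianProductWith difference xs xs ++ cartesianProductWith lower D xs)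

  D≤S : length D ≤ S
  D≤S = ℕ.≤-trans (length≤total D) (ℕ.m≤n+m _ (sizeᶜ β))

  xs≤S : length xs ≤ S
  xs≤S = vars-length≤total (β ∷ D)

  universe-length : length universe ≤ maxSteps S
  universe-length = s≤s (s≤s (begin
    length (map value-of xs ++ (diffs ++ lowers))         ≡⟨ length-++ (map value-of xs) ⟩
    length (map value-of xs) + length (diffs ++ lowers)   ≡⟨ cong₂ _+_ (length-map value-of xs) (length-++ diffs) ⟩
    length xs + (length diffs + length lowers)            ≡⟨ cong (_+_ (length xs)) (cong₂ _+_
                                                              (length-cartesianProductWith difference xs xs)
                                                              (length-cartesianProductWith lower D xs)) ⟩
    length xs + (length xs * length xs + length D * length xs)
      ≤⟨ ℕ.+-mono-≤ xs≤S (ℕ.+-mono-≤ (ℕ.*-mono-≤ xs≤S xs≤S) (ℕ.*-mono-≤ D≤S xs≤S)) ⟩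
    S + (S * S + S * S) ∎))
    where
    open ℕ.≤-Reasoning
    diffs  = cartesianProductWith difference xs xs
    lowers = cartesianProductWith lower D xs

  value-of∈ : ∀ {x} → x ∈ xs → value-of x ∈ universe
  value-of∈ x∈ = there (there (∈-++⁺ˡ (∈-map⁺ value-of x∈)))

  difference∈ : ∀ {x y} → x ∈ xs → y ∈ xs → difference x y ∈ universe
  difference∈ x∈ y∈ = there (there (∈-++⁺ʳ (map value-of xs) (∈-++⁺ˡ (∈-cartesianProductWith⁺ difference x∈ y∈))))

  lower∈ : ∀ {c y} → c ∈ D → y ∈ xs → lower c y ∈ universe
  lower∈ c∈ y∈ = there (there (∈-++⁺ʳ (map value-of xs)
    (∈-++⁺ʳ (cartesianProductWith difference xs xs) (∈-cartesianProductWith⁺ lower c∈ y∈))))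

  d : ℕ
  d = ℕ.pred (commonDenominator D)

  suc-d : suc d ≡ commonDenominator D
  suc-d = ℕ.suc-pred (commonDenominator D) {{commonDenominator≢0 D}}

  suc-d≤2^S : suc d ≤ 2 ^ S
  suc-d≤2^S = ℕ.≤-trans (ℕ.≤-reflexive suc-d)
    (ℕ.≤-trans (commonDenominator≤ D) (ℕ.^-monoʳ-≤ 2 (ℕ.m≤n+m _ (sizeᶜ β))))

  -- One `S` is for the input numerators, the other for expanding them to the common denominator,
  -- and `t` for one doubling per step.
  magnitude : ℕ → ℕ
  magnitude t = 2 ^ (S + S + t)

  magnitude-double : ∀ t → magnitude t + magnitude t ≡ magnitude (suc t)
  magnitude-double t = trans (cong (_+_ (magnitude t)) (sym (ℕ.+-identityʳ (magnitude t))))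
    (cong (2 ^_) (sym (ℕ.+-suc (S + S) t)))

  bits≤S : ∀ {x} → x ∈ xs → bits x ≤ S
  bits≤S x∈ with find (∈-concatMap⁻ vars {xs = β ∷ D} x∈)
  ... | c , c∈ , x∈c = ℕ.≤-trans (bits-var c x∈c) (sizeᶜ≤total c∈)

  data Origin (E : List Constraint) (x : Var) (q : ℚ) : Set where
    given   : x ≻ q ∈ D → Origin E x q
    shifted : ∀ {y r p} → y ≻ r ∈ D → y ⊕ p ≐ x ∈ E → q ≡ r ℚ.+ p → Origin E x q

  -- Here `t` is the number of derivation steps. The list `keys` has one distinct used key per step,
  -- so the pigeonhole principle bounds `t`.
  record Invariant (E : List Constraint) (t : ℕ) : Set where
    field
      sound   : ∀ {v} → All (v satisfies_) D → v ⊨ₑ E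
      loaded  : map represent D ⊆ E
      scope   : ∀ {c} → c ∈ E → vars c ⊆ xs
      tame    : ∀ {c} → c ∈ E → Tame d (magnitude t) c
      origin  : ∀ {x q} → x ≻ q ∈ E → Origin E x q
      steps   : length E ≡ t + length D
      keys    : List Key
      unique  : Unique keys
      keys⊆   : keys ⊆ universe
      used    : All (Used E) keys
      counted : length keys ≡ t

    t≤maxSteps : t ≤ maxSteps S
    t≤maxSteps = ℕ.≤-trans (ℕ.≤-reflexive (sym counted)) (ℕ.≤-trans (unique-length unique keys⊆) universe-length)

    length≤ : length E ≤ maxSteps S + S
    length≤ = ℕ.≤-trans (ℕ.≤-reflexive steps) (ℕ.+-mono-≤ t≤maxSteps D≤S)

  initially : Invariant (map represent D) 0
  initially = record
    { sound   = sound
    ; loaded  = λ c∈ → c∈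
    ; scope   = scope
    ; tame    = tame
    ; origin  = origin
    ; steps   = length-map represent D
    ; keys    = []
    ; unique  = []
    ; keys⊆   = λ ()
    ; used    = []
    ; counted = refl
    }
    where
    sound : ∀ {v} → All (v satisfies_) D → v ⊨ₑ map represent D
    sound {v} ⊨D c∈ with ∈-map⁻ represent c∈
    ... | b , b∈D , refl = represent-sound v b (All.lookup ⊨D b∈D)

    scope : ∀ {c} → c ∈ map represent D → vars c ⊆ xs
    scope c∈ x∈ with ∈-map⁻ represent c∈
    ... | b , b∈D , refl = ∈-concatMap⁺ vars (lose (there b∈D) (vars-represent b x∈))

    tame : ∀ {c} → c ∈ map represent D → Tame d (magnitude 0) c
    tame c∈ {q} q∈ with ∈-map⁻ represent c∈
    ... | b , b∈D , refl with constants-represent b q∈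
    ...   | inj₁ refl = fraction-0 _
    ...   | inj₂ q∈b = fraction-≤
      (begin
        ∣ ↥ q ∣ * suc d  ≤⟨ ℕ.*-mono-≤ (ℕ.≤-trans (ℕ.<⇒≤ (↥<2^bitsℚ q)) (ℕ.^-monoʳ-≤ 2
                              (ℕ.≤-trans (bits-constant b q∈b) (sizeᶜ≤total {D = β ∷ D} (there b∈D))))) suc-d≤2^S ⟩
        2 ^ S * 2 ^ S    ≡⟨ ℕ.^-distribˡ-+-* 2 S S ⟨
        2 ^ (S + S)      ≡⟨ cong (2 ^_) (ℕ.+-identityʳ (S + S)) ⟨
        magnitude 0      ∎)
      (↧∣⇒fraction q (subst₂ _∣_ (denominator-constant b q∈b) (sym suc-d) (∈⇒∣product (∈-map⁺ denominator b∈D))))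
      where open ℕ.≤-Reasoning

    origin : ∀ {x q} → x ≻ q ∈ map represent D → Origin (map represent D) x q
    origin c∈ with ∈-map⁻ represent c∈
    ... | b , b∈D , eq = given (subst (_∈ D) (sym (represent-≻ b eq)) b∈D)

  FreshKey : List Constraint → Constraint → Set
  FreshKey E c = ∃ λ k → k ∈ universe × ¬ Used E k × Used (c ∷ E) k

  -- A saturation step either completes a contradiction, or makes one inevitable, or concerns
  -- a pair of variables, a variable, or a translated input bound not treated before.
  freshKey : ∀ {E t c} → Invariant E t → ⊥ᶜ ∉ E → Fires xs E c byPriority →
    FreshKey E c
  freshKey {E} inv ⊥∉E fires = classify fires
    where
    open Invariant inv

    contradictory : FreshKey E ⊥ᶜ
    contradictory = bottom , here refl , (λ { (bottom ⊥∈E) → ⊥∉E ⊥∈E }) , bottom (here refl)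

    module _ (closed≠ : ClosedUnder xs E r≠) (closed≠⁺ : ClosedUnder xs E r≠⁺) where

      no-clash : ¬ Used E clash
      no-clash (clash-≐ x≐q x≐p q≢p) = ⊥∉E (closed≠ (by-≠ x≐q x≐p q≢p))
      no-clash (clash-⊕ x+q x+p q≢p) = ⊥∉E (closed≠⁺ (by-≠⁺ x+q x+p q≢p))

      -- A second link between the same variables can only be the first clash, because the rules
      -- detecting clashes are exhausted.
      new-link : ∀ {x q y r} → Inference xs E r (x ⊕ q ≐ y) → x ⊕ q ≐ y ∉ E →
        FreshKey E (x ⊕ q ≐ y)
      new-link {x} {q} {y} inf c∉E with linked? E x y
      ... | yes (p , x+p) = clash , there (here refl) , no-clash ,
        clash-⊕ (here refl) (there x+p) λ { refl → c∉E x+p }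
      ... | no ¬linked = difference x y ,
        difference∈ (inference-scope scope inf (here refl)) (inference-scope scope inf (there (here refl))) ,
        (λ { (difference x+p) → ¬linked (_ , x+p) }) , difference (here refl)

      new-value : ∀ {x q r} → Inference xs E r (x ≐ q) → x ≐ q ∉ E →
        FreshKey E (x ≐ q)
      new-value {x} {q} inf c∉E with valued? E x
      ... | yes (p , x≐p) = clash , there (here refl) , no-clash ,
        clash-≐ (here refl) (there x≐p) λ { refl → c∉E x≐p }
      ... | no ¬valued = value-of x , value-of∈ (inference-scope scope inf (here refl)) ,
        (λ { (value-of x≐p) → ¬valued (_ , x≐p) }) , value-of (here refl)

      new-bound : ∀ {x q r p} → x ≻ q ∈ D → x ⊕ p ≐ r ∈ E → r ≻ q ℚ.+ p ∉ E →
        FreshKey E (r ≻ q ℚ.+ p)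
      new-bound {x} {q} {r} {p} x≻q x+p c∉E = lower (x ≻ q) r , lower∈ x≻q (scope x+p (there (here refl))) ,
        unused , lower (there x+p) (here refl)
        where
        unused : ¬ Used E (lower (x ≻ q) r)
        -- An earlier shift of the same input bound to `r` used a link from `x` to `r`. With equal
        -- offsets the conclusion is old; with distinct ones R≠⁺ would apply.
        unused (lower {p = p′} x+p′ r≻) with p′ ℚ.≟ p
        ... | yes refl  = c∉E r≻
        ... | no  p′≢p = ⊥∉E (closed≠⁺ (by-≠⁺ x+p′ x+p p′≢p))

    classify : ∀ {c} → Fires xs E c byPriority → FreshKey E c
    classify (now (by-≠ _ _ _) _) = contradictory
    classify (later _ (now (by-≠⁺ _ _ _) _)) = contradictory
    classify (later _ (later _ (now (by-< _ _ _) _))) = contradictory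
    classify (later a (later b (later _ (now inf@(by-minus _ _) c∉E)))) = new-link a b inf c∉E
    classify (later a (later b (later _ (later _ (now inf@(by-↔ _) c∉E))))) = new-link a b inf c∉E
    classify (later a (later b (later _ (later _ (later _ (now inf@(by-₀ _) c∉E)))))) = new-link a b inf c∉E
    classify (later a (later b (later _ (later _ (later _ (later _ (now inf@(by-+ _ _) c∉E))))))) =
      new-link a b inf c∉E
    classify (later a (later b (later _ (later _ (later _ (later _ (later _ (now inf@(by-= _ _) c∉E)))))))) =
      new-value a b inf c∉E
    classify (later a (later b (later _ (later _ (later _ (later _ (later closed+
      (later _ (now (by-> x≻q x+p) c∉E))))))))) with origin x≻q
    ... | given x≻q∈D = new-bound a b x≻q∈D x+p c∉E
    -- The premise is itself a shifted input bound. As R₊ is exhausted, the composed link is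
    -- present, so the conclusion is a direct shift of that input bound.
    ... | shifted {r = r} {p = s} y≻r y+s refl = subst
      (λ q → FreshKey E (_ ≻ q)) (sym (ℚ.+-assoc r s _))
      (new-bound a b y≻r (closed+ (by-+ y+s x+p)) (c∉E ∘ subst (λ q → _ ≻ q ∈ E) (sym (ℚ.+-assoc r s _))))

  -- Only R> concludes a bound, and it fires after R₊ is exhausted. Composing links thus keeps each
  -- bound one link away from an input bound.
  inference-origin : ∀ {E t c x q} → Invariant E t → Fires xs E c byPriority → x ≻ q ≡ c → Origin E x q
  inference-origin inv (later _ (later _ (later _ (later _ (later _ (later _ (later closed+
    (later _ (now (by-> x≻q x+p) _))))))))) refl with Invariant.origin inv x≻q
  ... | given x≻q∈D = shifted x≻q∈D x+p refl
  ... | shifted {r = r} {p = s} y≻r y+s refl = shifted y≻r (closed+ (by-+ y+s x+p)) (ℚ.+-assoc r s _)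

  origin-∷ : ∀ {c E x q} → Origin E x q → Origin (c ∷ E) x q
  origin-∷ (given x≻q)          = given x≻q
  origin-∷ (shifted y≻r y+p eq) = shifted y≻r (there y+p) eq

  extend : ∀ {E t c} → Invariant E t → ⊥ᶜ ∉ E → Fires xs E c byPriority → Invariant (c ∷ E) (suc t)
  extend {E} {t} {c} inv ⊥∉E fires = record
    { sound   = λ where
        ⊨D (here refl) → inference-sound (sound ⊨D) inf
        ⊨D (there c∈)  → sound ⊨D c∈
    ; loaded  = there ∘ loaded
    ; scope   = λ where
        (here refl) → inference-scope scope inf
        (there c∈)  → scope c∈
    ; tame    = λ where
        (here refl) q∈ → fraction-≤ (ℕ.≤-reflexive (magnitude-double t)) (inference-tame tame inf q∈)
        (there c∈)  q∈ → fraction-≤ (ℕ.^-monoʳ-≤ 2 (ℕ.+-monoʳ-≤ (S + S) (ℕ.n≤1+n t))) (tame c∈ q∈)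
    ; origin  = λ where
        (here eq)  → origin-∷ (inference-origin inv fires eq)
        (there c∈) → origin-∷ (origin c∈)
    ; steps   = cong suc steps
    ; keys    = k ∷ keys
    ; unique  = All.map (λ { u refl → k-fresh u }) used ∷ unique
    ; keys⊆   = λ where
        (here refl) → k∈
        (there k′∈) → keys⊆ k′∈
    ; used    = k-used ∷ All.map used-∷ used
    ; counted = cong suc counted
    }
    where
    open Invariant inv
    inf     = proj₂ (proj₁ (fired fires))
    new     = freshKey inv ⊥∉E fires
    k       = proj₁ new
    k∈      = proj₁ (proj₂ new)
    k-fresh = proj₁ (proj₂ (proj₂ new))
    k-used  = proj₂ (proj₂ (proj₂ new))

-- Running time of the parts of the algorithm

-- ℓ bounds the lengths of the lists of constraints and variables, e the cost of an elementary operation.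
searchCost forEachCost pairsCost maxConclusions ruleCost candidatesCost answerCost : ℕ → ℕ → ℕ
searchCost     ℓ e = suc (ℓ * suc (3 * e))
forEachCost    ℓ e = suc (ℓ * (3 * e + 2))
pairsCost      ℓ e = suc (ℓ * (forEachCost ℓ e + suc ℓ))
maxConclusions ℓ e = ℓ * ℓ + ℓ
ruleCost       ℓ e = (pairsCost ℓ e + forEachCost ℓ e) + suc (maxConclusions ℓ e * (searchCost ℓ e + 2))
candidatesCost ℓ e = searchCost ℓ e + suc (9 * ruleCost ℓ e)
answerCost     ℓ e = searchCost ℓ e + (searchCost ℓ e + (searchCost ℓ e + searchCost ℓ e))

length-if : ∀ {A : Set} b (a : A) → length (if b then [ a ] else []) ≤ 1
length-if true  _ = s≤s z≤n
length-if false _ = z≤n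

module Costs (κ : ℕ → ℕ) {B e ℓ : ℕ} (cost : ∀ {n} → n ≤ B + B → suc (κ n) ≤ e) (1≤B : 1 ≤ B) where

  open Rules κ

  cost₂ : ∀ {m n} → m ≤ B → n ≤ B → suc (κ (m + n)) ≤ e
  cost₂ m≤B n≤B = cost (ℕ.+-mono-≤ m≤B n≤B)

  upTo3 : ∀ n {t} → n ≤ 3 → t ≤ n * e → t ≤ 3 * e
  upTo3 n n≤3 t≤ = ℕ.≤-trans t≤ (ℕ.*-monoˡ-≤ e n≤3)

  1≤3 : 1 ≤ 3
  1≤3 = s≤s z≤n

  2≤3 : 2 ≤ 3
  2≤3 = s≤s (s≤s z≤n)

  Small : Constraint → Set
  Small c = sizeᶜ c ≤ B

  var≤ : ∀ c {x} → Small c → x ∈ vars c → bits x ≤ B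
  var≤ c small x∈ = ℕ.≤-trans (bits-var c x∈) small

  constant≤ : ∀ c {q} → Small c → q ∈ constants c → bitsℚ q ≤ B
  constant≤ c small q∈ = ℕ.≤-trans (bits-constant c q∈) small

  -- Three comparisons are what R≠⁺ needs, the most of any rule on one pair of constraints.
  Cheap : {A : Set} → Timed (List A) → Set
  Cheap m = time m ≤ 3 * e × length (value m) ≤ 1

  cheap-idle : ∀ {A : Set} {m : Timed (List A)} → m ≡ return [] → Cheap m
  cheap-idle refl = z≤n , z≤n

  CheapRule : PairRule → Set
  CheapRule R = ∀ {a b} → Small a → Small b → Cheap (R a b)

  cheap-≠ : CheapRule R≠
  cheap-≠ {a} {b} sa sb with view-≠ a b
  ... | idle eq = cheap-idle eq
  ... | active (mk x q y p) = upTo3 2 2≤3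
    (ℕ.+-mono-≤ (cost₂ (var≤ a sa (here refl)) (var≤ b sb (here refl)))
    (ℕ.+-monoˡ-≤ 0 (cost₂ (constant≤ a sa (here refl)) (constant≤ b sb (here refl))))) ,
    length-if (does (x ℕ.≟ y) ∧ not (does (q ℚ.≟ p))) ⊥ᶜ

  cheap-≠⁺ : CheapRule R≠⁺
  cheap-≠⁺ {a} {b} sa sb with view-≠⁺ a b
  ... | idle eq = cheap-idle eq
  ... | active (mk x q y x′ p y′) =
    ℕ.+-mono-≤ (cost₂ (var≤ a sa (here refl)) (var≤ b sb (here refl)))
    (ℕ.+-mono-≤ (cost₂ (var≤ a sa (there (here refl))) (var≤ b sb (there (here refl))))
    (ℕ.+-monoˡ-≤ 0 (cost₂ (constant≤ a sa (here refl)) (constant≤ b sb (here refl))))) ,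
    length-if (does (x ℕ.≟ x′) ∧ does (y ℕ.≟ y′) ∧ not (does (q ℚ.≟ p))) ⊥ᶜ

  cheap-< : CheapRule R<
  cheap-< {a} {b} sa sb with view-< a b
  ... | idle eq = cheap-idle eq
  ... | active (mk x q y p) = upTo3 2 2≤3
    (ℕ.+-mono-≤ (cost₂ (var≤ a sa (here refl)) (var≤ b sb (here refl)))
    (ℕ.+-monoˡ-≤ 0 (cost₂ (constant≤ a sa (here refl)) (constant≤ b sb (here refl))))) ,
    length-if (does (x ℕ.≟ y) ∧ does (q ℚ.≤? p)) ⊥ᶜ

  cheap-minus : CheapRule R-
  cheap-minus {a} {b} sa sb with view-minus a b
  ... | idle eq = cheap-idle eq
  ... | active (mk x q y p) = upTo3 1 1≤3
    (ℕ.+-monoˡ-≤ 0 (cost₂ (constant≤ b sb (here refl)) (constant≤ a sa (here refl)))) , s≤s z≤n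

  cheap-+ : CheapRule R+
  cheap-+ {a} {b} sa sb with view-+ a b
  ... | idle eq = cheap-idle eq
  ... | active (mk x q y x′ p y′) = upTo3 2 2≤3
    (ℕ.+-mono-≤ (cost₂ (var≤ a sa (there (here refl))) (var≤ b sb (here refl)))
    (ℕ.+-monoˡ-≤ 0 (cost₂ (constant≤ a sa (here refl)) (constant≤ b sb (here refl))))) ,
    length-if (does (y ℕ.≟ x′)) (x ⊕ q ℚ.+ p ≐ y′)

  cheap-= : CheapRule R=
  cheap-= {a} {b} sa sb with view-= a b
  ... | idle eq = cheap-idle eq
  ... | active (mk x q x′ p y) = upTo3 2 2≤3
    (ℕ.+-mono-≤ (cost₂ (var≤ a sa (here refl)) (var≤ b sb (here refl)))
    (ℕ.+-monoˡ-≤ 0 (cost₂ (constant≤ a sa (here refl)) (constant≤ b sb (here refl))))) ,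
    length-if (does (x ℕ.≟ x′)) (y ≐ q ℚ.+ p)

  cheap-> : CheapRule R>
  cheap-> {a} {b} sa sb with view-> a b
  ... | idle eq = cheap-idle eq
  ... | active (mk x q x′ p y) = upTo3 2 2≤3
    (ℕ.+-mono-≤ (cost₂ (var≤ a sa (here refl)) (var≤ b sb (here refl)))
    (ℕ.+-monoˡ-≤ 0 (cost₂ (constant≤ a sa (here refl)) (constant≤ b sb (here refl))))) ,
    length-if (does (x ℕ.≟ x′)) (y ≻ q ℚ.+ p)

  cheap-↔ : ∀ {a} → Small a → Cheap (R↔ a)
  cheap-↔ {⊤ᶜ _}        sa = z≤n , z≤n
  cheap-↔ {⊥ᶜ}          sa = z≤n , z≤n
  cheap-↔ {_ ≐ _}       sa = z≤n , z≤n
  cheap-↔ {_ ≻ _}       sa = z≤n , z≤n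
  cheap-↔ {a@(_ ⊕ _ ≐ _)} sa =
    upTo3 1 1≤3 (ℕ.+-monoˡ-≤ 0 (cost (ℕ.m≤n⇒m≤n+o B (constant≤ a sa (here refl))))) , s≤s z≤n

  module _ {A : Set} {f : A → Timed (List Constraint)} {as : List A} (as≤ℓ : length as ≤ ℓ)
    (cheap : ∀ {a} → a ∈ as → Cheap (f a)) where

    time-forEach-cheap : time (forEach as f) ≤ forEachCost ℓ e
    time-forEach-cheap = ℕ.≤-trans (time-forEach as (proj₁ ∘ cheap) (proj₂ ∘ cheap))
      (s≤s (ℕ.*-monoˡ-≤ (3 * e + 2) as≤ℓ))

    length-forEach-cheap : length (value (forEach as f)) ≤ ℓ
    length-forEach-cheap = ℕ.≤-trans (length-forEach as (proj₂ ∘ cheap))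
      (ℕ.≤-trans (ℕ.≤-reflexive (ℕ.*-identityʳ _)) as≤ℓ)

  module _ {xs E} (xs≤ℓ : length xs ≤ ℓ) (E≤ℓ : length E ≤ ℓ) (small : ∀ {c} → c ∈ E → Small c)
    (small-conclusions : ∀ {r c} → Inference xs E r c → Small c) where

    time-∈? : ∀ {c} → Small c → time (c ∈? E) ≤ searchCost ℓ e
    time-∈? {c} sc = ℕ.≤-trans (time-exists E λ d∈E → cost₂ sc (small d∈E))
      (s≤s (ℕ.*-mono-≤ E≤ℓ (s≤s (ℕ.m≤m+n e _))))

    pairs-cost : ∀ {R} → CheapRule R →
      time (pairs R E) ≤ pairsCost ℓ e × length (value (pairs R E)) ≤ ℓ * ℓ
    pairs-cost {R} cheap =
      ℕ.≤-trans (time-forEach E (λ a∈ → time-forEach-cheap E≤ℓ (inner a∈)) (λ a∈ → length-forEach-cheap E≤ℓ (inner a∈)))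
        (s≤s (ℕ.*-monoˡ-≤ _ E≤ℓ)) ,
      ℕ.≤-trans (length-forEach E (λ a∈ → length-forEach-cheap E≤ℓ (inner a∈))) (ℕ.*-monoˡ-≤ ℓ E≤ℓ)
      where
      inner : ∀ {a} → a ∈ E → ∀ {b} → b ∈ E → Cheap (R a b)
      inner a∈E b∈E = cheap (small a∈E) (small b∈E)

    BoundedRule : Timed (List Constraint) → Set
    BoundedRule m = time m ≤ pairsCost ℓ e + forEachCost ℓ e × length (value m) ≤ maxConclusions ℓ e

    pairs-bounded : ∀ {R} → CheapRule R → BoundedRule (pairs R E)
    pairs-bounded cheap = let t≤ , l≤ = pairs-cost cheap in
      ℕ.m≤n⇒m≤n+o (forEachCost ℓ e) t≤ , ℕ.m≤n⇒m≤n+o ℓ l≤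

    forEach-bounded : ∀ {A : Set} {f : A → Timed (List Constraint)} {as} → length as ≤ ℓ →
      (∀ {a} → a ∈ as → Cheap (f a)) → BoundedRule (forEach as f)
    forEach-bounded as≤ℓ cheap =
      ℕ.m≤n⇒m≤o+n (pairsCost ℓ e) (time-forEach-cheap as≤ℓ cheap) ,
      ℕ.m≤n⇒m≤o+n (ℓ * ℓ) (length-forEach-cheap as≤ℓ cheap)

    conclusions-bounded : ∀ r → BoundedRule (conclusions xs r E)
    conclusions-bounded r≠  = pairs-bounded cheap-≠
    conclusions-bounded r≠⁺ = pairs-bounded cheap-≠⁺
    conclusions-bounded r<  = pairs-bounded cheap-<
    conclusions-bounded r-  = pairs-bounded cheap-minus
    conclusions-bounded r↔  = forEach-bounded E≤ℓ λ c∈E → cheap-↔ (small c∈E)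
    conclusions-bounded r₀  = forEach-bounded {f = R₀} {as = xs} xs≤ℓ λ _ → z≤n , s≤s z≤n
    conclusions-bounded r+  = pairs-bounded cheap-+
    conclusions-bounded r=  = pairs-bounded cheap-=
    conclusions-bounded r>  = pairs-bounded cheap->

    -- The conclusions are compared with `E` before old ones are discarded, so the sizes of all
    -- conclusions matter, not only those of members of `E`.
    time-notIn : ∀ r → time (notIn E (value (conclusions xs r E))) ≤ suc (maxConclusions ℓ e * (searchCost ℓ e + 2))
    time-notIn r = ℕ.≤-trans
      (time-forEach cs
        (λ c∈ → ℕ.≤-trans (ℕ.≤-reflexive (ℕ.+-identityʳ _)) (time-∈? (small-conclusions (∈-conclusions⁻ r c∈))))
        (λ {c} _ → at-most-one (value (c ∈? E))))
      (s≤s (ℕ.*-monoˡ-≤ (searchCost ℓ e + 2) (proj₂ (conclusions-bounded r))))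
      where
      cs = value (conclusions xs r E)
      at-most-one : ∀ b {c : Constraint} → length (if b then [] else [ c ]) ≤ 1
      at-most-one true  = z≤n
      at-most-one false = s≤s z≤n

    time-firstNew-∷ : ∀ r rs → time (firstNew (map (conclusions xs) (r ∷ rs)) E) ≤
      time (conclusions xs r E) +
        (time (notIn E (value (conclusions xs r E))) + time (firstNew (map (conclusions xs) rs) E))
    time-firstNew-∷ r rs with value (notIn E (value (conclusions xs r E)))
    ... | []    = ℕ.≤-refl
    ... | _ ∷ _ = ℕ.+-monoʳ-≤ (time (conclusions xs r E))
      (ℕ.+-monoʳ-≤ (time (notIn E (value (conclusions xs r E)))) z≤n)

    time-firstNew : ∀ rs → time (firstNew (map (conclusions xs) rs) E) ≤ suc (length rs * ruleCost ℓ e)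
    time-firstNew []       = s≤s z≤n
    time-firstNew (r ∷ rs) = begin
      time (firstNew (map (conclusions xs) (r ∷ rs)) E)
        ≤⟨ time-firstNew-∷ r rs ⟩
      time (conclusions xs r E) + (time (notIn E (value (conclusions xs r E))) + time (firstNew (map (conclusions xs) rs) E))
        ≤⟨ ℕ.+-mono-≤ (proj₁ (conclusions-bounded r)) (ℕ.+-mono-≤ (time-notIn r) (time-firstNew rs)) ⟩
      (pairsCost ℓ e + forEachCost ℓ e) + (suc (maxConclusions ℓ e * (searchCost ℓ e + 2)) + suc (length rs * ruleCost ℓ e))
        ≡⟨ ℕ.+-assoc (pairsCost ℓ e + forEachCost ℓ e) _ _ ⟨
      ruleCost ℓ e + suc (length rs * ruleCost ℓ e)
        ≡⟨ ℕ.+-suc (ruleCost ℓ e) _ ⟩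
      suc (length (r ∷ rs) * ruleCost ℓ e) ∎
      where open ℕ.≤-Reasoning

    time-candidates : time (candidates xs E) ≤ candidatesCost ℓ e
    time-candidates = ℕ.+-mono-≤ (time-∈? {⊥ᶜ} 1≤B) continue
      where
      continue : time (if value (⊥ᶜ ∈? E) then return [] else firstNew (rules xs) E) ≤ suc (9 * ruleCost ℓ e)
      continue with value (⊥ᶜ ∈? E)
      ... | true  = z≤n
      ... | false = time-firstNew byPriority

    time-equalityAbove : ∀ {x q} → Small (x ≻ q) → ∀ {c} → Small c → time (equalityAbove x q c) ≤ 3 * e
    time-equalityAbove _  {⊤ᶜ _}      _  = z≤n
    time-equalityAbove _  {⊥ᶜ}        _  = z≤n
    time-equalityAbove _  {_ ≻ _}     _  = z≤n
    time-equalityAbove _  {_ ⊕ _ ≐ _} _  = z≤n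
    time-equalityAbove {x} {q} sβ {c@(_ ≐ _)} sc = upTo3 2 2≤3
      (ℕ.+-mono-≤ (cost₂ (var≤ (x ≻ q) sβ (here refl)) (var≤ c sc (here refl)))
      (ℕ.+-monoˡ-≤ 0 (cost₂ (constant≤ (x ≻ q) sβ (here refl)) (constant≤ c sc (here refl)))))

    time-lowerBoundAbove : ∀ {x q} → Small (x ≻ q) → ∀ {c} → Small c → time (lowerBoundAbove x q c) ≤ 3 * e
    time-lowerBoundAbove _  {⊤ᶜ _}      _  = z≤n
    time-lowerBoundAbove _  {⊥ᶜ}        _  = z≤n
    time-lowerBoundAbove _  {_ ≐ _}     _  = z≤n
    time-lowerBoundAbove _  {_ ⊕ _ ≐ _} _  = z≤n
    time-lowerBoundAbove {x} {q} sβ {c@(_ ≻ _)} sc = upTo3 2 2≤3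
      (ℕ.+-mono-≤ (cost₂ (var≤ (x ≻ q) sβ (here refl)) (var≤ c sc (here refl)))
      (ℕ.+-monoˡ-≤ 0 (cost₂ (constant≤ (x ≻ q) sβ (here refl)) (constant≤ c sc (here refl)))))

    time-exists-small : ∀ {f} → (∀ {c} → Small c → time (f c) ≤ 3 * e) → time (exists E f) ≤ searchCost ℓ e
    time-exists-small f≤ = ℕ.≤-trans (time-exists E (f≤ ∘ small)) (s≤s (ℕ.*-monoˡ-≤ (suc (3 * e)) E≤ℓ))

    time-bounded : ∀ {β} → Small β → time (bounded E β) ≤ searchCost ℓ e + searchCost ℓ e
    time-bounded {⊤ᶜ _}      _ = z≤n
    time-bounded {⊥ᶜ}        _ = z≤n
    time-bounded {_ ≐ _}     _ = z≤n
    time-bounded {_ ⊕ _ ≐ _} _ = z≤n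
    time-bounded {x ≻ q}     sβ = ℕ.+-mono-≤ (time-exists-small (time-equalityAbove sβ)) continue
      where
      continue : time (if value (exists E (equalityAbove x q)) then return true
        else exists E (lowerBoundAbove x q)) ≤ searchCost ℓ e
      continue with value (exists E (equalityAbove x q))
      ... | true  = z≤n
      ... | false = time-exists-small (time-lowerBoundAbove sβ)

    time-answer : ∀ {β} → Small β → time (answer E β) ≤ answerCost ℓ e
    time-answer {β} sβ = ℕ.+-mono-≤ (time-∈? {⊥ᶜ} 1≤B) (ℕ.+-mono-≤ (time-∈? sβ) continue)
      where
      continue : time (if value (⊥ᶜ ∈? E) ∨ value (β ∈? E) then return true else bounded E β)
        ≤ searchCost ℓ e + searchCost ℓ e
      continue with value (⊥ᶜ ∈? E) ∨ value (β ∈? E)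
      ... | true  = z≤n
      ... | false = time-bounded sβ

-- Correctness of the final test

module Answers (κ : ℕ → ℕ) where

  open Rules κ

  bounded-sound : ∀ {E v} β → value (bounded E β) ≡ true → v ⊨ₑ E → v satisfies β
  bounded-sound {E} {v} (x ≻ q) eq ⊨E with value (exists E (equalityAbove x q)) in eq₁
  ... | true with exists⁻ E eq₁
  ...   | y ≐ p , y≐p , both with ∧-true both
  ...     | same , q<p with does-true (x ℕ.≟ y) same
  ...       | refl = subst (q ℚ.<_) (sym (⊨E y≐p)) (does-true (q ℚ.<? p) q<p)
  bounded-sound {E} {v} (x ≻ q) eq ⊨E | false with exists⁻ E eq
  ...   | y ≻ p , y≻p , both with ∧-true both
  ...     | same , q≤p with does-true (x ℕ.≟ y) same
  ...       | refl = ℚ.≤-<-trans (does-true (q ℚ.≤? p) q≤p) (⊨E y≻p)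

  answer-sound : ∀ {E v} β → value (answer E β) ≡ true → v ⊨ₑ E → v satisfies β
  answer-sound {E} β eq ⊨E with value (⊥ᶜ ∈? E) in eq₁ | value (β ∈? E) in eq₂
  ... | true  | _     = ⊥-elim (⊨E (∈?⁻ E eq₁))
  ... | false | true  = ⊨E (∈?⁻ E eq₂)
  ... | false | false = bounded-sound β eq ⊨E

  answer-⊥ : ∀ {E} β → ⊥ᶜ ∈ E → value (answer E β) ≡ true
  answer-⊥ β ⊥∈E rewrite ∈?⁺ ⊥∈E = refl

  answer-∈ : ∀ {E} β → β ∈ E → value (answer E β) ≡ true
  answer-∈ {E} β β∈E rewrite ∈?⁺ β∈E with value (⊥ᶜ ∈? E)
  ... | true  = refl
  ... | false = refl

  answer-bounded : ∀ {E} β → value (bounded E β) ≡ true → value (answer E β) ≡ true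
  answer-bounded {E} β eq with value (⊥ᶜ ∈? E) ∨ value (β ∈? E)
  ... | true  = refl
  ... | false = eq

  bounded-by-value : ∀ {E x q p} → x ≐ p ∈ E → q ℚ.< p → value (bounded E (x ≻ q)) ≡ true
  bounded-by-value {E} {x} {q} {p} x≐p q<p
    rewrite exists⁺ {f = equalityAbove x q} x≐p (cong₂ _∧_ (dec-true (x ℕ.≟ x) refl) (dec-true (q ℚ.<? p) q<p)) = refl

  bounded-by-bound : ∀ {E x q p} → x ≻ p ∈ E → q ℚ.≤ p → value (bounded E (x ≻ q)) ≡ true
  bounded-by-bound {E} {x} {q} {p} x≻p q≤p with value (exists E (equalityAbove x q))
  ... | true  = refl
  ... | false = exists⁺ {f = lowerBoundAbove x q} x≻p
    (cong₂ _∧_ (dec-true (x ℕ.≟ x) refl) (dec-true (q ℚ.≤? p) q≤p))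

-- The costs are polynomial

poly-search : ∀ {f g} → Poly f → Poly g → Poly (λ n → searchCost (f n) (g n))
poly-search f g = poly-suc (poly-* f (poly-suc (poly-* (poly-const 3) g)))

poly-forEach : ∀ {f g} → Poly f → Poly g → Poly (λ n → forEachCost (f n) (g n))
poly-forEach f g = poly-suc (poly-* f (poly-+ (poly-* (poly-const 3) g) (poly-const 2)))

poly-pairs : ∀ {f g} → Poly f → Poly g → Poly (λ n → pairsCost (f n) (g n))
poly-pairs f g = poly-suc (poly-* f (poly-+ (poly-forEach f g) (poly-suc f)))

poly-rule : ∀ {f g} → Poly f → Poly g → Poly (λ n → ruleCost (f n) (g n))
poly-rule f g = poly-+ (poly-+ (poly-pairs f g) (poly-forEach f g))
  (poly-suc (poly-* (poly-+ (poly-* f f) f) (poly-+ (poly-search f g) (poly-const 2))))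

poly-candidates : ∀ {f g} → Poly f → Poly g → Poly (λ n → candidatesCost (f n) (g n))
poly-candidates f g = poly-+ (poly-search f g) (poly-suc (poly-* (poly-const 9) (poly-rule f g)))

poly-answer : ∀ {f g} → Poly f → Poly g → Poly (λ n → answerCost (f n) (g n))
poly-answer f g = poly-+ s (poly-+ s (poly-+ s s))
  where s = poly-search f g

poly-maxSteps : Poly maxSteps
poly-maxSteps = poly-+ (poly-const 2) (poly-+ poly-id (poly-+ (poly-* poly-id poly-id) (poly-* poly-id poly-id)))

-- The bound of `size-tame` for variables of `n` bits, a denominator up to `2 ^ n`, and numerators
-- after `suc (maxSteps n)` doublings. The extra doubling covers conclusions computed from the last
-- set.
maxSize : ℕ → ℕ
maxSize n = suc (n + suc (suc (n + n + suc (maxSteps n)) + suc n) + n)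

poly-maxSize : Poly maxSize
poly-maxSize = poly-suc (poly-+ (poly-+ poly-id (poly-suc (poly-+ (poly-suc (poly-+ (poly-+ poly-id poly-id)
  (poly-suc poly-maxSteps))) (poly-suc poly-id)))) poly-id)

-- Runs: time, termination and correctness

module Analysis (κ : ℕ → ℕ) (c k : ℕ) (κ≤ : ∀ n → κ n ≤ c * n ^ k + c) where

  open Rules κ
  open Answers κ

  elementaryCost maxLength stepCost timeBound : ℕ → ℕ
  elementaryCost n = suc (c * (maxSize n + maxSize n) ^ k + c)
  maxLength      n = maxSteps n + n
  stepCost       n = suc (candidatesCost (maxLength n) (elementaryCost n))
  -- Loading, then the derivation steps, then the last search for candidates together with the
  -- answer.
  timeBound      n = suc n + maxSteps n * stepCost n + (stepCost n + answerCost (maxLength n) (elementaryCost n))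

  poly-elementaryCost : Poly elementaryCost
  poly-elementaryCost = poly-suc (poly-+ (poly-* (poly-const c) (poly-^ k (poly-+ poly-maxSize poly-maxSize))) (poly-const c))

  poly-maxLength : Poly maxLength
  poly-maxLength = poly-+ poly-maxSteps poly-id

  poly-stepCost : Poly stepCost
  poly-stepCost = poly-suc (poly-candidates poly-maxLength poly-elementaryCost)

  poly-timeBound : Poly timeBound
  poly-timeBound = poly-+ (poly-+ (poly-suc poly-id) (poly-* poly-maxSteps poly-stepCost))
    (poly-+ poly-stepCost (poly-answer poly-maxLength poly-elementaryCost))

  module _ (D : List Constraint) (β : Constraint) where

    open Invariants D β

    small : ∀ {b} → vars b ⊆ xs → Tame d (magnitude (suc (maxSteps S))) b → sizeᶜ b ≤ maxSize S
    small {b} scope tame = size-tame b (bits≤S ∘ scope) suc-d≤2^S tame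

    S≤maxSize : S ≤ maxSize S
    S≤maxSize = ℕ.m≤n⇒m≤1+n (ℕ.m≤n⇒m≤n+o S (ℕ.m≤m+n S _))

    vars-β : vars β ⊆ xs
    vars-β = ∈-++⁺ˡ

    -- A trivial link is larger than the ⊤ that it replaces, so that case is bounded through its
    -- variable and the constant 0.
    small-represent : ∀ b → vars b ⊆ xs → sizeᶜ b ≤ maxSize S → sizeᶜ (represent b) ≤ maxSize S
    small-represent (⊤ᶜ x)      scope _  =
      small {x ⊕ 0ℚ ≐ x} (scope ∘ vars-represent (⊤ᶜ x)) λ { (here refl) → fraction-0 _ }
    small-represent ⊥ᶜ          _     b≤ = b≤
    small-represent (_ ≐ _)     _     b≤ = b≤
    small-represent (_ ≻ _)     _     b≤ = b≤
    small-represent (_ ⊕ _ ≐ _) _     b≤ = b≤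

    small-β : sizeᶜ (represent β) ≤ maxSize S
    small-β = small-represent β vars-β (ℕ.≤-trans (sizeᶜ≤total {D = β ∷ D} (here refl)) S≤maxSize)

    -- The passage to the largest operand size takes place inside the polynomial bound, which is
    -- monotone.
    elementary≤ : ∀ {n} → n ≤ maxSize S + maxSize S → suc (κ n) ≤ elementaryCost S
    elementary≤ {n} n≤ = s≤s (ℕ.≤-trans (κ≤ n) (ℕ.+-monoˡ-≤ c (ℕ.*-monoʳ-≤ c (ℕ.^-monoˡ-≤ k n≤))))

    module _ {E t} (inv : Invariant E t) where

      open Invariant inv
      open Costs κ {ℓ = maxLength S} elementary≤ (s≤s z≤n)

      small-member : ∀ {b} → b ∈ E → sizeᶜ b ≤ maxSize S
      small-member {b} b∈E = small {b} (scope b∈E) λ q∈ → fraction-≤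
        (ℕ.^-monoʳ-≤ 2 (ℕ.+-monoʳ-≤ (S + S) (ℕ.m≤n⇒m≤1+n t≤maxSteps))) (tame b∈E q∈)

      small-conclusion : ∀ {r b} → Inference xs E r b → sizeᶜ b ≤ maxSize S
      small-conclusion {b = b} inf = small {b} (inference-scope scope inf) λ q∈ → fraction-≤
        (ℕ.≤-trans (ℕ.≤-reflexive (magnitude-double t)) (ℕ.^-monoʳ-≤ 2 (ℕ.+-monoʳ-≤ (S + S) (s≤s t≤maxSteps))))
        (inference-tame tame inf q∈)

      xs≤maxLength : length xs ≤ maxLength S
      xs≤maxLength = ℕ.≤-trans xs≤S (ℕ.m≤n+m S (maxSteps S))

      candidates-time : suc (time (candidates xs E)) ≤ stepCost S
      candidates-time = s≤s (time-candidates xs≤maxLength length≤ small-member small-conclusion)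

      answer-time : time (answer E (represent β)) ≤ answerCost (maxLength S) (elementaryCost S)
      answer-time = time-answer xs≤maxLength length≤ small-member small-conclusion small-β

      derive-step : ∀ {b} → b ∈ value (candidates xs E) → Invariant (b ∷ E) (suc t)
      derive-step b∈ = let ⊥∉E , fires = ∈-candidates⁻ E b∈ in extend inv ⊥∉E fires

      answer-correct : value (candidates xs E) ≡ [] → (value (answer E (represent β)) ≡ true) ⇔ (D ⊨ β)
      answer-correct none = mk⇔
        (λ eq v ⊨D → represent-complete v β (answer-sound (represent β) eq (sound ⊨D)))
        answers
        where
        answers : D ⊨ β → value (answer E (represent β)) ≡ true
        answers D⊨β with candidates≡[] E none
        ... | inj₁ ⊥∈E = answer-⊥ (represent β) ⊥∈E
        ... | inj₂ (consistent , closed) = detects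
          (complete β vars-β λ v ⊨E → D⊨β v (All.tabulate λ {b} b∈D →
            represent-complete v b (⊨E (loaded (∈-map⁺ represent b∈D)))))
          where
          open Saturated {xs} {E} consistent closed
          detects : ∀ {b} → Detected b → value (answer E (represent b)) ≡ true
          detects (member b∈E)               = answer-∈ _ b∈E
          detects {x ≻ q} (by-value x≐p q<p) = answer-bounded {E} (x ≻ q) (bounded-by-value x≐p q<p)
          detects {x ≻ q} (by-bound x≻p q≤p) = answer-bounded {E} (x ≻ q) (bounded-by-bound x≻p q≤p)

    -- The elapsed time `t` is kept apart from the number `j` of derivation steps, through which it
    -- is bounded.
    data Status : ℕ → State → Set where
      at-input      : Status 0 input
      at-saturating : ∀ {E j t} → Invariant E j → t ≤ suc S + j * stepCost S → Status t (saturating E)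
      at-returned   : ∀ {E j t} → Invariant E j → value (candidates xs E) ≡ [] → t ≤ timeBound S →
        Status t (returned (value (answer E (represent β))))

    saturating-time : ∀ {E j} → Invariant E j → suc S + j * stepCost S ≤ suc S + maxSteps S * stepCost S
    saturating-time inv = ℕ.+-monoʳ-≤ (suc S) (ℕ.*-monoˡ-≤ (stepCost S) (Invariant.t≤maxSteps inv))

    status : ∀ {t s} → Run D β t s → Status t s
    status start = at-input
    status (run then load) with status run
    ... | at-input = at-saturating initially (ℕ.m≤m+n (suc S) 0)
    status (run then derive b∈) with status run
    ... | at-saturating {j = j} inv t≤ = at-saturating (derive-step inv b∈) (ℕ.≤-trans
      (ℕ.+-mono-≤ t≤ (candidates-time inv))
      (ℕ.≤-reflexive (trans (ℕ.+-assoc (suc S) _ _) (cong (_+_ (suc S)) (ℕ.+-comm (j * stepCost S) (stepCost S))))))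
    status (run then finish none) with status run
    ... | at-saturating inv t≤ = at-returned inv none
      (ℕ.+-mono-≤ (ℕ.≤-trans t≤ (saturating-time inv)) (ℕ.+-mono-≤ (candidates-time inv) (answer-time inv)))

    status-time : ∀ {t s} → Status t s → t ≤ timeBound S
    status-time at-input               = z≤n
    status-time (at-saturating inv t≤) = ℕ.m≤n⇒m≤n+o _ (ℕ.≤-trans t≤ (saturating-time inv))
    status-time (at-returned _ _ t≤)   = t≤

    progress : ∀ s → (∃ λ b → s ≡ returned b) ⊎ (∃₂ λ u s′ → Step D β s u s′)
    progress input          = inj₂ (_ , _ , load)
    progress (returned b)   = inj₁ (b , refl)
    progress (saturating E) = inj₂ (next (value (candidates xs E)) refl)
      where
      next : ∀ cs → value (candidates xs E) ≡ cs → ∃₂ λ u s′ → Step D β (saturating E) u s′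
      next []       eq = _ , _ , finish eq
      next (b ∷ cs) eq = _ , _ , derive (subst (b ∈_) (sym eq) (here refl))

    Terminates : State → Set
    Terminates = Acc (λ s′ s → ∃ λ u → Step D β s u s′)

    -- The fuel bounds the number of keys left. A step taken without fuel would need more than
    -- `maxSteps S` distinct keys.
    saturating-terminates : ∀ fuel {E j} → Invariant E j → maxSteps S ≤ fuel + j → Terminates (saturating E)
    saturating-terminates fuel {E} {j} inv enough = acc λ where
        (_ , finish _)  → acc λ ()
        (_ , derive b∈) → continue fuel enough (derive-step inv b∈)
      where
      continue : ∀ fuel {b} → maxSteps S ≤ fuel + j → Invariant (b ∷ E) (suc j) → Terminates (saturating (b ∷ E))
      continue zero       enough inv′ = contradiction (ℕ.≤-trans (Invariant.t≤maxSteps inv′) enough) (ℕ.<-irrefl refl)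
      continue (suc fuel) enough inv′ = saturating-terminates fuel inv′
        (ℕ.≤-trans enough (ℕ.≤-reflexive (sym (ℕ.+-suc fuel j))))

    terminates : TerminatesWithin D β (timeBound S)
    terminates = record
      { noInfiniteRun = acc λ { (_ , load) → saturating-terminates (maxSteps S) initially (ℕ.m≤m+n _ 0) }
      ; neverStuck    = λ {_} {s} _ → progress s
      ; timeBound     = λ run → status-time (status run)
      }

    decides : Decides D β
    decides run with status run
    ... | at-returned inv none _ = answer-correct inv none

theorem2 : (κ : ℕ → ℕ) → PolynomiallyBounded κ →
    (∃[ T ] PolynomiallyBounded T × (∀ D β → Algorithm.TerminatesWithin κ D β (T (size D β))))
    × (∀ D β → Algorithm.Decides κ D β)
theorem2 κ (c , k , κ≤) =
  (timeBound , Poly⇒PolynomiallyBounded poly-timeBound , terminates) , decides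
  where open Analysis κ c k κ≤
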